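{- As power series in $q$, $$\sum_{n=0}^{\infty}a^{o}_{ed}(n)q^n=\frac{(-q^2;q^2)_{\infty}}{(q;q^2)_{\infty}}\left(\sum_{n=0}^{\infty}\frac{q^{2n^2+n}}{(-q^2;q^2)_n}-\sum_{n=0}^{\infty}\frac{q^{(2n+1)(n+1)}}{(-q^2;q^2)_n}\right)$$ and $$\sum_{n=0}^{\infty}a^{e}_{ed}(n)q^n=\frac{(-q^2;q^2)_{\infty}}{(q;q^2)_{\infty}}\sum_{n=0}^{\infty}\frac{q^{2n^2-n}}{(-q^2;q^2)_n}.$$
   Context: Notation: $(a;q)_0:=1$, $(a;q)_n:=\prod_{k=0}^{n-1}(1-aq^k)$, $(a;q)_\infty:=\lim_{n\to\infty}(a;q)_n$. For $n\ge 0$, $\mathcal{P}_{ed}(n)$ is the set of all partitions of $n$ in which no even part is repeated (each even part appears at most once; odd parts may appear with any multiplicity). The empty partition is the unique element of $\mathcal{P}_{ed}(0)$. For a partition $\lambda$, $\mathrm{mex}(\lambda)$ is the smallest positive integer that is not a part of $\lambda$. Define $$a^{o}_{ed}(n):=\#\{\lambda\in\mathcal{P}_{ed}(n): \mathrm{mex}(\lambda)\equiv 1 \pmod 2\},\qquad a^{e}_{ed}(n):=\#\{\lambda\in\mathcal{P}_{ed}(n): \mathrm{mex}(\lambda)\equiv 0 \pmod 2\}.$$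
   Formalization: In the second identity the sum starts at n = 1 instead of n = 0: as printed, the n = 0 term makes the constant term of the right side 1, whereas a^e_ed(0) = 0 since the empty partition has mex 1. -}

module Defs where

open import Data.Fin.Base using (Fin; zero; suc; toℕ)
open import Data.Fin.Properties using (toℕ≤pred[n])
open import Data.Integer.Base as ℤ using (ℤ; 0ℤ; 1ℤ)
import Data.Integer.Properties as ℤP
open import Algebra.Properties.Semiring.Sum ℤP.+-*-semiring using (sum-syntax; sum⁺-syntax; sum-cong-≗; sum-replicate-zero)
open import Data.List.Base using (List; []; _∷_; _++_; length; map; concatMap; filter; replicate; upTo)
open import Data.List.Membership.Propositional using (_∈_; _∉_; find; lose)
open import Data.List.Membership.Propositional.Properties using (∈-map⁺; ∈-map⁻; ∈-concatMap⁺; ∈-concatMap⁻; ∈-upTo⁺; ∈-upTo⁻)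
open import Data.List.Properties using (++-cancelˡ; ∷-injectiveʳ)
open import Data.List.Relation.Binary.Disjoint.Propositional using (Disjoint)
open import Data.List.Relation.Unary.All as All using (All; []; _∷_; all?)
import Data.List.Relation.Unary.All.Properties as AllP
open import Data.List.Relation.Unary.AllPairs as AllPairs using ([]; _∷_)
import Data.List.Relation.Unary.AllPairs.Properties as AllPairsP
open import Data.List.Relation.Unary.Any using (here)
open import Data.List.Relation.Unary.Linked as Linked using (Linked; []; [-]; _∷_)
open import Data.List.Relation.Unary.Unique.Propositional using (Unique)
import Data.List.Relation.Unary.Unique.Propositional.Properties as UniqueP
open import Data.Nat.Base using (ℕ; zero; suc; _+_; _*_; _∸_; _^_; _/_; _%_; _≤_; _<_; _≥_; z≤n; s≤s; _≤′_; ≤′-refl; ≤′-step)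
open import Data.Nat.Divisibility using (_∣_; _∣?_)
open import Data.Nat.DivMod using (m/n*n≤m; m*n/n≡m; /-monoˡ-≤)
open import Data.Nat.ListAction using (sum)
open import Data.Nat.Properties
open import Data.List.Membership.DecPropositional _≟_ using (_∈?_)
open import Data.Product.Base using (∃; _×_; _,_; proj₁; proj₂)
open import Function.Base using (_∘_)
open import Relation.Binary.PropositionalEquality using (_≡_; _≢_; refl; sym; trans; cong; cong₂; module ≡-Reasoning)
open import Relation.Nullary.Decidable using (yes; no; _→-dec_)
open import Relation.Nullary.Negation using (contradiction)
open import Relation.Unary using (Decidable)

------------------------------------------------------------------------
-- Formal power series in q over ℤ, as coefficient functions

Series : Set
Series = ℕ → ℤ

infix  4 _≈ₛ_
infixl 6 _+ₛ_ _-ₛ_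
infixl 7 _*ₛ_ _/ₛ_
infixr 8 _^ₛ_ -ₛ_

_≈ₛ_ : Series → Series → Set
f ≈ₛ g = ∀ k → f k ≡ g k

0ₛ 1ₛ q : Series
0ₛ _ = 0ℤ

1ₛ zero    = 1ℤ
1ₛ (suc _) = 0ℤ

q zero          = 0ℤ
q (suc zero)    = 1ℤ
q (suc (suc _)) = 0ℤ

_+ₛ_ _-ₛ_ _*ₛ_ : Series → Series → Series
(f +ₛ g) k = f k ℤ.+ g k
(f -ₛ g) k = f k ℤ.- g k
(f *ₛ g) k = ∑[ i ≤ k ] (f (toℕ i) ℤ.* g (k ∸ toℕ i))

-ₛ_ : Series → Series
(-ₛ f) k = ℤ.- f k

_^ₛ_ : Series → ℕ → Series
f ^ₛ zero  = 1ₛ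
f ^ₛ suc n = f *ₛ (f ^ₛ n)

-- Reciprocal of a series with constant term 1 (junk otherwise), by
-- c₀ = 1, cₙ₊₁ = - (g₁ cₙ + g₂ cₙ₋₁ + ⋯ + gₙ₊₁ c₀);
-- recipCoeffs g n is the list cₙ₋₁, …, c₀.
dot : Series → List ℤ → ℤ
dot g []       = 0ℤ
dot g (c ∷ cs) = g 0 ℤ.* c ℤ.+ dot (g ∘ suc) cs

nextCoeff : Series → List ℤ → ℤ
nextCoeff g []         = 1ℤ
nextCoeff g cs@(_ ∷ _) = ℤ.- dot (g ∘ suc) cs

recipCoeffs : Series → ℕ → List ℤ
recipCoeffs g zero    = []
recipCoeffs g (suc n) = nextCoeff g (recipCoeffs g n) ∷ recipCoeffs g n

recip : Series → Series
recip g n = nextCoeff g (recipCoeffs g n)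

_/ₛ_ : Series → Series → Series
f /ₛ g = f *ₛ recip g

dot-recipCoeffs : ∀ g h n → dot h (recipCoeffs g (suc n)) ≡ (h *ₛ recip g) n
dot-recipCoeffs g h zero    = refl
dot-recipCoeffs g h (suc n) =
  cong (λ z → h 0 ℤ.* recip g (suc n) ℤ.+ z) (dot-recipCoeffs g (h ∘ suc) n)

recip-inverse : ∀ g → g 0 ≡ 1ℤ → g *ₛ recip g ≈ₛ 1ₛ
recip-inverse g g₀≡1 zero    rewrite g₀≡1 = refl
recip-inverse g g₀≡1 (suc n) = begin
  g 0 ℤ.* recip g (suc n) ℤ.+ ((g ∘ suc) *ₛ recip g) n
    ≡⟨ cong₂ ℤ._+_ (trans (cong (ℤ._* recip g (suc n)) g₀≡1) (ℤP.*-identityˡ _)) (sym (dot-recipCoeffs g (g ∘ suc) n)) ⟩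
  ℤ.- dot (g ∘ suc) (recipCoeffs g (suc n)) ℤ.+ dot (g ∘ suc) (recipCoeffs g (suc n))
    ≡⟨ ℤP.+-inverseˡ (dot (g ∘ suc) (recipCoeffs g (suc n))) ⟩
  0ℤ ∎
  where open ≡-Reasoning

------------------------------------------------------------------------
-- Limits in ℤ[[q]]: each coefficient is eventually constant

Convergent : (ℕ → Series) → Set
Convergent s = ∀ k → ∃ λ N → ∀ n → N ≤ n → s n k ≡ s N k

lim : (s : ℕ → Series) → Convergent s → Series
lim s c k = s (proj₁ (c k)) k

partialSum : (ℕ → Series) → ℕ → Series
partialSum f zero    = 0ₛ
partialSum f (suc n) = partialSum f n +ₛ f n

Summable : (ℕ → Series) → Set
Summable f = Convergent (partialSum f)

-- ∑from m f _  is  f m + f (m + 1) + f (m + 2) + ⋯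
∑from : (m : ℕ) (f : ℕ → Series) → Summable (λ n → f (m + n)) → Series
∑from m f c = lim (partialSum (λ n → f (m + n))) c

-- poch a b n  is  (a;b)ₙ
poch : Series → Series → ℕ → Series
poch a b zero    = 1ₛ
poch a b (suc n) = (1ₛ -ₛ a *ₛ b ^ₛ n) *ₛ poch a b n

-- Order≥ n f  says that qⁿ divides f
Order≥ : ℕ → Series → Set
Order≥ n f = ∀ k → k < n → f k ≡ 0ℤ

sum-zero : ∀ n (t : Fin n → ℤ) → (∀ i → t i ≡ 0ℤ) → ∑[ i < n ] t i ≡ 0ℤ
sum-zero n t t≡0 = trans (sum-cong-≗ t≡0) (sum-replicate-zero n)

Order≥-weaken : ∀ {m n} f → m ≤ n → Order≥ n f → Order≥ m f
Order≥-weaken f m≤n o k k<m = o k (<-≤-trans k<m m≤n)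

Order≥-*ˡ : ∀ {n} f g → Order≥ n f → Order≥ n (f *ₛ g)
Order≥-*ˡ f g o k k<n = sum-zero (suc k) _ λ i →
  trans (cong (ℤ._* g (k ∸ toℕ i)) (o (toℕ i) (≤-<-trans (toℕ≤pred[n] i) k<n)))
        (ℤP.*-zeroˡ (g (k ∸ toℕ i)))

Order≥-*ʳ : ∀ {n} f g → Order≥ n g → Order≥ n (f *ₛ g)
Order≥-*ʳ f g o k k<n = sum-zero (suc k) _ λ i →
  trans (cong (f (toℕ i) ℤ.*_) (o (k ∸ toℕ i) (≤-<-trans (m∸n≤m k (toℕ i)) k<n)))
        (ℤP.*-zeroʳ (f (toℕ i)))

Order≥-^ : ∀ b → b 0 ≡ 0ℤ → ∀ n → Order≥ n (b ^ₛ n)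
Order≥-^ b b₀≡0 (suc n) k (s≤s k≤n) = sum-zero (suc k) (λ i → b (toℕ i) ℤ.* (b ^ₛ n) (k ∸ toℕ i)) λ
  { zero    → trans (cong (ℤ._* (b ^ₛ n) k) b₀≡0) (ℤP.*-zeroˡ ((b ^ₛ n) k))
  ; (suc i) → trans (cong (b (suc (toℕ i)) ℤ.*_)
                      (Order≥-^ b b₀≡0 n (k ∸ suc (toℕ i)) (pred-< k k≤n i)))
                    (ℤP.*-zeroʳ (b (suc (toℕ i)))) }
  where
  pred-< : ∀ k → k ≤ n → (i : Fin k) → k ∸ suc (toℕ i) < n
  pred-< (suc k) k<n i = ≤-<-trans (m∸n≤m k (toℕ i)) k<n

stable⇒convergent : ∀ s → (∀ n k → k < n → s (suc n) k ≡ s n k) → Convergent s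
stable⇒convergent s step k = suc k , λ n k<n → go (≤⇒≤′ k<n)
  where
  go : ∀ {n} → suc k ≤′ n → s n k ≡ s (suc k) k
  go ≤′-refl                = refl
  go (≤′-step {n = n} k<′n) = trans (step n k (≤′⇒≤ k<′n)) (go k<′n)

Order≥⇒summable : ∀ f → (∀ n → Order≥ n (f n)) → Summable f
Order≥⇒summable f o = stable⇒convergent (partialSum f) λ n k k<n →
  trans (cong (λ z → partialSum f n k ℤ.+ z) (o n k k<n)) (ℤP.+-identityʳ (partialSum f n k))

q-powers-summable : ∀ (e : ℕ → ℕ) (g : ℕ → Series) → (∀ n → n ≤ e n) →
                    Summable (λ n → q ^ₛ e n /ₛ g n)
q-powers-summable e g n≤e = Order≥⇒summable _ λ n →
  Order≥-weaken _ (n≤e n) (Order≥-*ˡ (q ^ₛ e n) (recip (g n)) (Order≥-^ q refl (e n)))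

poch-convergent : ∀ a b → b 0 ≡ 0ℤ → Convergent (poch a b)
poch-convergent a b b₀≡0 = stable⇒convergent (poch a b) step
  where
  step : ∀ n k → k < n → poch a b (suc n) k ≡ poch a b n k
  step n k k<n = begin
    u 0 ℤ.* p k ℤ.+ ∑[ i < k ] (u (suc (toℕ i)) ℤ.* p (k ∸ suc (toℕ i)))
      ≡⟨ cong₂ ℤ._+_ (trans (cong (ℤ._* p k) (u≡1 0 z≤n)) (ℤP.*-identityˡ (p k)))
           (sum-zero k _ λ i → trans (cong (ℤ._* p (k ∸ suc (toℕ i))) (u≡1 (suc (toℕ i)) (i<k k i)))
                                     (ℤP.*-zeroˡ (p (k ∸ suc (toℕ i))))) ⟩
    p k ℤ.+ 0ℤ
      ≡⟨ ℤP.+-identityʳ (p k) ⟩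
    p k ∎
    where
    open ≡-Reasoning
    u = 1ₛ -ₛ a *ₛ b ^ₛ n
    p = poch a b n
    i<k : ∀ k → (i : Fin k) → suc (toℕ i) ≤ k
    i<k (suc k) i = s≤s (toℕ≤pred[n] i)
    u≡1 : ∀ j → j ≤ k → u j ≡ 1ₛ j
    u≡1 j j≤k = trans (cong (λ z → 1ₛ j ℤ.- z) (Order≥-*ʳ a (b ^ₛ n) (Order≥-^ b b₀≡0 n) j (≤-<-trans j≤k k<n)))
                      (ℤP.+-identityʳ (1ₛ j))

-- poch∞ a b _  is  (a;b)_∞
poch∞ : (a b : Series) → b 0 ≡ 0ℤ → Series
poch∞ a b b₀≡0 = lim (poch a b) (poch-convergent a b b₀≡0)

-- With the next two lemmas, recip-inverse applies to every denominator below.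
poch-constant : ∀ a b → a 0 ≡ 0ℤ → ∀ n → poch a b n 0 ≡ 1ℤ
poch-constant a b a₀≡0 zero    = refl
poch-constant a b a₀≡0 (suc n)
  rewrite a₀≡0 | poch-constant a b a₀≡0 n | ℤP.*-zeroˡ ((b ^ₛ n) 0) = refl

poch∞-constant : ∀ a b (b₀≡0 : b 0 ≡ 0ℤ) → a 0 ≡ 0ℤ → poch∞ a b b₀≡0 0 ≡ 1ℤ
poch∞-constant a b b₀≡0 a₀≡0 = poch-constant a b a₀≡0 1

q² : Series
q² = q ^ₛ 2

summable-2n²+n : Summable (λ n → q ^ₛ (2 * n ^ 2 + n) /ₛ poch (-ₛ q²) q² n)
summable-2n²+n = q-powers-summable (λ n → 2 * n ^ 2 + n) _ λ n → m≤n+m n (2 * n ^ 2)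

summable-[2n+1][n+1] : Summable (λ n → q ^ₛ ((2 * n + 1) * (n + 1)) /ₛ poch (-ₛ q²) q² n)
summable-[2n+1][n+1] = q-powers-summable (λ n → (2 * n + 1) * (n + 1)) _ λ n → begin
  n                     ≤⟨ m≤m+n n 1 ⟩
  n + 1                 ≡⟨ +-identityʳ (n + 1) ⟨
  1 * (n + 1)           ≤⟨ *-monoˡ-≤ (n + 1) (m≤n+m 1 (2 * n)) ⟩
  (2 * n + 1) * (n + 1) ∎
  where open ≤-Reasoning

-- The index starts at 1: the n-th term accounts for mex = 2n, and mex is
-- positive. The source prints the sum from n = 0, which is false:
-- the n = 0 term would add the whole product (-q²;q²)_∞/(q;q²)_∞, and the
-- constant term would become 1, whereas aᵉed 0 = 0 (the empty partition has mex 1).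
summable-2n²-n : Summable (λ n → q ^ₛ (2 * (1 + n) ^ 2 ∸ (1 + n)) /ₛ poch (-ₛ q²) q² (1 + n))
summable-2n²-n = q-powers-summable (λ n → 2 * (1 + n) ^ 2 ∸ (1 + n)) (λ n → poch (-ₛ q²) q² (1 + n)) λ n →
  ≤-trans (<⇒≤ (n<1+n n)) (bound (suc n) (m≤m*n (suc n) (suc n * 1)))
  where
  bound : ∀ m → m ≤ m ^ 2 → m ≤ 2 * m ^ 2 ∸ m
  bound m m≤m² = begin
    m                       ≡⟨ m+n∸n≡m m m ⟨
    (m + m) ∸ m             ≡⟨ cong (λ z → (m + z) ∸ m) (+-identityʳ m) ⟨
    2 * m ∸ m               ≤⟨ ∸-monoˡ-≤ m (*-monoʳ-≤ 2 m≤m²) ⟩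
    2 * m ^ 2 ∸ m           ∎
    where open ≤-Reasoning

------------------------------------------------------------------------
-- Partitions, as weakly decreasing lists of positive integers

IsPartition : ℕ → List ℕ → Set
IsPartition n λs = Linked _≥_ λs × All (1 ≤_) λs × sum λs ≡ n

-- The partitions of n into parts ≤ m, sorted by the number k of parts equal to m.
boundedPartitions : ℕ → ℕ → List (List ℕ)
boundedPartitions zero    zero    = [] ∷ []
boundedPartitions zero    (suc _) = []
boundedPartitions (suc m) n       =
  concatMap (λ k → map (replicate k (suc m) ++_) (boundedPartitions m (n ∸ k * suc m)))
            (upTo (suc (n / suc m)))

partitions : ℕ → List (List ℕ)
partitions n = boundedPartitions n n

sum-replicate-++ : ∀ k x ys → sum (replicate k x ++ ys) ≡ k * x + sum ys
sum-replicate-++ zero    x ys = refl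
sum-replicate-++ (suc k) x ys =
  trans (cong (λ z → x + z) (sum-replicate-++ k x ys)) (sym (+-assoc x (k * x) (sum ys)))

linked-cons : ∀ {x ys} → All (_≤ x) ys → Linked _≥_ ys → Linked _≥_ (x ∷ ys)
linked-cons []      []        = [-]
linked-cons (p ∷ _) l@[-]     = p ∷ l
linked-cons (p ∷ _) l@(_ ∷ _) = p ∷ l

linked-bound : ∀ {x ys} → Linked _≥_ (x ∷ ys) → All (_≤ x) ys
linked-bound [-]     = []
linked-bound (p ∷ l) = p ∷ All.map (λ r → ≤-trans r p) (linked-bound l)

replicate-all : ∀ {P : ℕ → Set} k {x ys} → P x → All P ys → All P (replicate k x ++ ys)
replicate-all zero    px pys = pys
replicate-all (suc k) px pys = px ∷ replicate-all k px pys

linked-replicate : ∀ k {x ys} → All (_≤ x) ys → Linked _≥_ ys → Linked _≥_ (replicate k x ++ ys)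
linked-replicate zero    b l = l
linked-replicate (suc k) b l = linked-cons (replicate-all k ≤-refl b) (linked-replicate k b l)

withCopies : ℕ → ℕ → ℕ → List (List ℕ)
withCopies m n k = map (replicate k (suc m) ++_) (boundedPartitions m (n ∸ k * suc m))

boundedPartitions-sound : ∀ m n {λs} → λs ∈ boundedPartitions m n → IsPartition n λs × All (_≤ m) λs
boundedPartitions-sound zero    zero (here refl) = ([] , [] , refl) , []
boundedPartitions-sound (suc m) n λs∈
  with find (∈-concatMap⁻ (withCopies m n) {xs = upTo (suc (n / suc m))} λs∈)
... | k , k∈ , λs∈k with ∈-map⁻ (replicate k (suc m) ++_) λs∈k
... | ys , ys∈ , refl with boundedPartitions-sound m (n ∸ k * suc m) ys∈ | ∈-upTo⁻ k∈
... | (l , pos , s) , b | s≤s k≤n/m =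
  ( linked-replicate k b′ l
  , replicate-all k (s≤s z≤n) pos
  , trans (sum-replicate-++ k (suc m) ys)
      (trans (cong (λ z → k * suc m + z) s)
        (m+[n∸m]≡n (≤-trans (*-monoˡ-≤ (suc m) k≤n/m) (m/n*n≤m n (suc m))))) )
  , replicate-all k ≤-refl b′
  where
  b′ : All (_≤ suc m) ys
  b′ = All.map (λ p → ≤-trans p (<⇒≤ (n<1+n m))) b

split-copies : ∀ m λs → Linked _≥_ λs → All (_≤ suc m) λs →
               ∃ λ k → ∃ λ ys → λs ≡ replicate k (suc m) ++ ys × Linked _≥_ ys × All (_≤ m) ys
split-copies m []       l b = 0 , [] , refl , [] , []
split-copies m (x ∷ xs) l (x≤ ∷ b) with x ≟ suc m
... | yes refl with split-copies m xs (Linked.tail l) b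
...   | k , ys , refl , l′ , b′ = suc k , ys , refl , l′ , b′
split-copies m (x ∷ xs) l (x≤ ∷ b) | no x≢ with ≤∧≢⇒< x≤ x≢
...   | s≤s x≤m = 0 , x ∷ xs , refl , l , x≤m ∷ All.map (λ r → ≤-trans r x≤m) (linked-bound l)

boundedPartitions-complete : ∀ m n {λs} → IsPartition n λs → All (_≤ m) λs → λs ∈ boundedPartitions m n
boundedPartitions-complete zero n {[]}     (l , pos , refl)    b        = here refl
boundedPartitions-complete zero n {x ∷ xs} (l , 1≤x ∷ _ , _) (x≤0 ∷ _) = contradiction x≤0 (<⇒≱ 1≤x)
boundedPartitions-complete (suc m) n {λs} (l , pos , s) b with split-copies m λs l b
... | k , ys , refl , l′ , b′ =
  ∈-concatMap⁺ (withCopies m n) {xs = upTo (suc (n / suc m))}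
    (lose (∈-upTo⁺ (s≤s k≤n/m))
      (∈-map⁺ (replicate k (suc m) ++_)
        (boundedPartitions-complete m (n ∸ k * suc m)
          (l′ , AllP.++⁻ʳ (replicate k (suc m)) pos , sum-ys) b′)))
  where
  n≡ : n ≡ k * suc m + sum ys
  n≡ = trans (sym s) (sum-replicate-++ k (suc m) ys)
  sum-ys : sum ys ≡ n ∸ k * suc m
  sum-ys = sym (trans (cong (_∸ k * suc m) n≡) (m+n∸m≡n (k * suc m) (sum ys)))
  k≤n/m : k ≤ n / suc m
  k≤n/m = ≤-trans (≤-reflexive (sym (m*n/n≡m k (suc m))))
            (/-monoˡ-≤ (suc m) (≤-trans (m≤m+n (k * suc m) (sum ys)) (≤-reflexive (sym n≡))))

copies-injective : ∀ m k k′ ys ys′ → All (_≤ m) ys → All (_≤ m) ys′ →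
                   replicate k (suc m) ++ ys ≡ replicate k′ (suc m) ++ ys′ → k ≡ k′
copies-injective m zero    zero     _ _ _ _ _ = refl
copies-injective m (suc k) (suc k′) ys ys′ b b′ eq =
  cong suc (copies-injective m k k′ ys ys′ b b′ (∷-injectiveʳ eq))
copies-injective m zero    (suc k′) _ _ (y≤m ∷ _) _ refl = contradiction y≤m (<⇒≱ (n<1+n m))
copies-injective m (suc k) zero     _ _ _ (y≤m ∷ _) refl = contradiction y≤m (<⇒≱ (n<1+n m))

boundedPartitions-unique : ∀ m n → Unique (boundedPartitions m n)
boundedPartitions-unique zero    zero    = [] ∷ []
boundedPartitions-unique zero    (suc n) = []
boundedPartitions-unique (suc m) n       = UniqueP.concat⁺
  (AllP.map⁺ (All.universal
    (λ k → UniqueP.map⁺ (++-cancelˡ (replicate k (suc m)) _ _) (boundedPartitions-unique m (n ∸ k * suc m)))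
    (upTo (suc (n / suc m)))))
  (AllPairsP.map⁺ (AllPairs.map disjoint (UniqueP.upTo⁺ (suc (n / suc m)))))
  where
  same : ∀ {k k′ λs} → λs ∈ withCopies m n k → λs ∈ withCopies m n k′ → k ≡ k′
  same {k} {k′} p p′ with ∈-map⁻ (replicate k (suc m) ++_) p | ∈-map⁻ (replicate k′ (suc m) ++_) p′
  ... | ys , ys∈ , refl | ys′ , ys′∈ , eq =
    copies-injective m k k′ ys ys′
      (proj₂ (boundedPartitions-sound m _ ys∈)) (proj₂ (boundedPartitions-sound m _ ys′∈)) eq
  disjoint : ∀ {k k′} → k ≢ k′ → Disjoint (withCopies m n k) (withCopies m n k′)
  disjoint k≢k′ (p , p′) = k≢k′ (same p p′)

parts≤sum : ∀ λs → All (_≤ sum λs) λs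
parts≤sum []       = []
parts≤sum (x ∷ xs) = m≤m+n x (sum xs) ∷ All.map (λ r → ≤-trans r (m≤n+m (sum xs) x)) (parts≤sum xs)

-- partitions n lists every partition of n exactly once.
partitions-sound : ∀ n {λs} → λs ∈ partitions n → IsPartition n λs
partitions-sound n λs∈ = proj₁ (boundedPartitions-sound n n λs∈)

partitions-complete : ∀ n {λs} → IsPartition n λs → λs ∈ partitions n
partitions-complete n {λs} p@(_ , _ , refl) = boundedPartitions-complete n n p (parts≤sum λs)

partitions-unique : ∀ n → Unique (partitions n)
partitions-unique n = boundedPartitions-unique n n

multiplicity : ℕ → List ℕ → ℕ
multiplicity p λs = length (filter (p ≟_) λs)

EvenPartsDistinct : List ℕ → Set
EvenPartsDistinct λs = All (λ p → 2 ∣ p → multiplicity p λs ≤ 1) λs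

evenPartsDistinct? : Decidable EvenPartsDistinct
evenPartsDistinct? λs = all? (λ p → (2 ∣? p) →-dec (multiplicity p λs ≤? 1)) λs

Ped : ℕ → List (List ℕ)
Ped n = filter evenPartsDistinct? (partitions n)

IsMex : List ℕ → ℕ → Set
IsMex λs m = 1 ≤ m × m ∉ λs × (∀ j → 1 ≤ j → j < m → j ∈ λs)

mexFrom : (fuel k : ℕ) → List ℕ → ℕ
mexFrom zero       k λs = k
mexFrom (suc fuel) k λs with k ∈? λs
... | yes _ = mexFrom fuel (suc k) λs
... | no  _ = k

-- The fuel is enough because 1 + sum λs exceeds every part.
mex : List ℕ → ℕ
mex λs = mexFrom (sum λs) 1 λs

mex-isMex : ∀ λs → IsMex λs (mex λs)
mex-isMex λs = go (sum λs) 1 refl ≤-refl (λ j 1≤j j<1 → contradiction 1≤j (<⇒≱ j<1))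
  where
  go : ∀ fuel k → fuel + k ≡ sum λs + 1 → 1 ≤ k → (∀ j → 1 ≤ j → j < k → j ∈ λs) →
       IsMex λs (mexFrom fuel k λs)
  go zero k refl 1≤k below = 1≤k
    , (λ k∈ → <⇒≱ (≤-reflexive (+-comm 1 (sum λs))) (All.lookup (parts≤sum λs) k∈))
    , below
  go (suc fuel) k eq 1≤k below with k ∈? λs
  ... | no  k∉ = 1≤k , k∉ , below
  ... | yes k∈ = go fuel (suc k) (trans (+-suc fuel k) eq) (s≤s z≤n) below′
    where
    below′ : ∀ j → 1 ≤ j → j < suc k → j ∈ λs
    below′ j 1≤j (s≤s j≤k) with j ≟ k
    ... | yes refl = k∈
    ... | no  j≢k  = below j 1≤j (≤∧≢⇒< j≤k j≢k)

aᵒed aᵉed : ℕ → ℕ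
aᵒed n = length (filter (λ λs → mex λs % 2 ≟ 1) (Ped n))
aᵉed n = length (filter (λ λs → mex λs % 2 ≟ 0) (Ped n))

genFun : (ℕ → ℕ) → Series
genFun a n = ℤ.+ a n

{-# OPTIONS --safe #-}

-- A partition counted by aᵒed or aᵉed has mex t exactly when each part p occurs
-- at least once for p < t, never for p = t, and at most once for p even. These
-- conditions are independent, so the generating function for mex t and parts ≤ m is
-- a product over p; multiplied by ∏ (1 - qᵖ) over odd p ≤ m, its factor at p becomes
-- qᵖ for p < t, and 1 or 1 + qᵖ for p > t. Hence it equals
-- q^(t(t-1)/2) · (1 - qᵗ if t is odd) · ∏ (1 + qᵖ) over even p with t < p ≤ m.
-- Summing over t of one parity gives the theorem; the coefficient of qⁿ only
-- involves t ≤ n + 1 and parts ≤ n, so all infinite products and sums can be truncated.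
module Submission where

open import Algebra.Bundles using (CommutativeRing)
open import Data.Bool.Base using (true; false; if_then_else_)
open import Data.Fin.Base using (toℕ)
open import Data.Fin.Properties using (toℕ≤pred[n])
open import Data.Integer.Base as ℤ using (ℤ; 0ℤ; 1ℤ)
import Data.Integer.Properties as ℤP
open import Data.Integer.Tactic.RingSolver using (solve-∀)
open import Algebra.Properties.Semiring.Sum ℤP.+-*-semiring using (sum-cong-≗)
open import Data.List.Base using (List; []; _∷_; _++_; length; map; concatMap; filter; replicate; applyUpTo; upTo)
open import Data.List.Membership.Propositional using (_∈_; _∉_)
open import Data.List.Membership.Propositional.Properties using (∈-upTo⁺; ∈-upTo⁻)
import Data.List.Properties as List
open import Data.List.Relation.Unary.All as All using (All)
open import Data.List.Relation.Unary.All.Properties using (¬Any⇒All¬)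
open import Data.List.Relation.Unary.AllPairs using (_∷_)
open import Data.List.Relation.Unary.Any using (here; there)
open import Data.List.Relation.Unary.Unique.Propositional using (Unique)
import Data.List.Relation.Unary.Unique.Propositional.Properties as Unique
open import Data.Nat.Base using (ℕ; zero; suc; _+_; _*_; _∸_; _^_; _/_; _%_; _≤_; _<_; z≤n; s≤s)
open import Data.Nat.Divisibility using (_∣_; _∣?_; divides; ∣m+n∣m⇒∣n; ∣1⇒≡1)
open import Data.Nat.DivMod using (m<n⇒m/n≡0; m/n≡1+[m∸n]/n; m≡m%n+[m/n]*n; [m+kn]%n≡m%n; m%n<n)
open import Data.Nat.ListAction using (sum)
open import Data.Nat.Properties using (_≟_; _≤?_; _<?_)
import Data.Nat.Properties as ℕP
import Data.Nat.Tactic.RingSolver as ℕSolver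
open import Data.List.Membership.DecPropositional _≟_ using (_∈?_)
open import Data.Product.Base using (∃; _×_; _,_; proj₁; proj₂)
open import Data.Sum.Base using (inj₁; inj₂)
open import Data.Unit.Base using (⊤; tt)
open import Function.Base using (_∘_)
open import Function.Bundles using (_⇔_; mk⇔)
open import Level using (0ℓ)
open import Relation.Binary.Definitions using (tri<; tri≈; tri>)
open import Relation.Binary.PropositionalEquality using (_≡_; _≢_; refl; sym; trans; cong; cong₂; subst; module ≡-Reasoning)
open import Relation.Nullary.Decidable using (Dec; yes; no; does; _because_; _→-dec_; _×-dec_; does-⇔; dec-true; dec-false)
open import Relation.Nullary.Negation using (¬_; contradiction)
open import Defs

-- The ring ℤ[[q]]

-- Coefficient `n` of a product involves only coefficients up to `n` of the factors. This later
-- allows infinite products and sums to be replaced by finite stages, one coefficient at a time.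
*ₛ-local : ∀ {f f′ g g′} n → (∀ k → k ≤ n → f k ≡ f′ k) → (∀ k → k ≤ n → g k ≡ g′ k) →
           (f *ₛ g) n ≡ (f′ *ₛ g′) n
*ₛ-local n f≈f′ g≈g′ = sum-cong-≗ {suc n} λ i →
  cong₂ ℤ._*_ (f≈f′ (toℕ i) (toℕ≤pred[n] i)) (g≈g′ (n ∸ toℕ i) (ℕP.m∸n≤m n (toℕ i)))

*ₛ-cong : ∀ {f f′ g g′} → f ≈ₛ f′ → g ≈ₛ g′ → f *ₛ g ≈ₛ f′ *ₛ g′
*ₛ-cong f≈f′ g≈g′ n = *ₛ-local n (λ k _ → f≈f′ k) (λ k _ → g≈g′ k)

0ₛ-*ₛ : ∀ g → 0ₛ *ₛ g ≈ₛ 0ₛ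
0ₛ-*ₛ g n = sum-zero (suc n) _ λ i → ℤP.*-zeroˡ (g (n ∸ toℕ i))

*ₛ-identityˡ : ∀ g → 1ₛ *ₛ g ≈ₛ g
*ₛ-identityˡ g zero    = trans (ℤP.+-identityʳ _) (ℤP.*-identityˡ (g 0))
*ₛ-identityˡ g (suc n) =
  trans (cong₂ ℤ._+_ (ℤP.*-identityˡ (g (suc n))) (0ₛ-*ₛ g n)) (ℤP.+-identityʳ (g (suc n)))

*ₛ-distribʳ : ∀ h f g → (f +ₛ g) *ₛ h ≈ₛ f *ₛ h +ₛ g *ₛ h
*ₛ-distribʳ h f g zero = lemma (f 0) (g 0) (h 0)
  where
  lemma : ∀ a b c → (a ℤ.+ b) ℤ.* c ℤ.+ 0ℤ ≡ (a ℤ.* c ℤ.+ 0ℤ) ℤ.+ (b ℤ.* c ℤ.+ 0ℤ)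
  lemma = solve-∀
*ₛ-distribʳ h f g (suc n) =
  trans (cong (λ z → (f 0 ℤ.+ g 0) ℤ.* h (suc n) ℤ.+ z) (*ₛ-distribʳ h (f ∘ suc) (g ∘ suc) n))
        (lemma (f 0) (g 0) (h (suc n)) (((f ∘ suc) *ₛ h) n) (((g ∘ suc) *ₛ h) n))
  where
  lemma : ∀ a b c x y → (a ℤ.+ b) ℤ.* c ℤ.+ (x ℤ.+ y) ≡ (a ℤ.* c ℤ.+ x) ℤ.+ (b ℤ.* c ℤ.+ y)
  lemma = solve-∀

scale-*ₛ : ∀ a f g n → ((λ k → a ℤ.* f k) *ₛ g) n ≡ a ℤ.* (f *ₛ g) n
scale-*ₛ a f g zero = lemma a (f 0) (g 0)
  where
  lemma : ∀ a x y → a ℤ.* x ℤ.* y ℤ.+ 0ℤ ≡ a ℤ.* (x ℤ.* y ℤ.+ 0ℤ)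
  lemma = solve-∀
scale-*ₛ a f g (suc n) =
  trans (cong (λ z → a ℤ.* f 0 ℤ.* g (suc n) ℤ.+ z) (scale-*ₛ a (f ∘ suc) g n))
        (lemma a (f 0) (g (suc n)) (((f ∘ suc) *ₛ g) n))
  where
  lemma : ∀ a x y z → a ℤ.* x ℤ.* y ℤ.+ a ℤ.* z ≡ a ℤ.* (x ℤ.* y ℤ.+ z)
  lemma = solve-∀

-- At `suc n` a convolution unfolds by definition into its first summand plus the convolution of
-- `f ∘ suc` with `g` at `n`. The tail of `f *ₛ g` is thus `f0g′ +ₛ f′ *ₛ g`, and the induction on
-- `n` passes to the tail of `f`.
*ₛ-assoc : ∀ f g h → (f *ₛ g) *ₛ h ≈ₛ f *ₛ (g *ₛ h)
*ₛ-assoc f g h zero = lemma (f 0) (g 0) (h 0)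
  where
  lemma : ∀ a b c → (a ℤ.* b ℤ.+ 0ℤ) ℤ.* c ℤ.+ 0ℤ ≡ a ℤ.* (b ℤ.* c ℤ.+ 0ℤ) ℤ.+ 0ℤ
  lemma = solve-∀
*ₛ-assoc f g h (suc n) = begin
  (f 0 ℤ.* g 0 ℤ.+ 0ℤ) ℤ.* h (suc n) ℤ.+ ((f0g′ +ₛ f′ *ₛ g) *ₛ h) n
    ≡⟨ cong (λ z → (f 0 ℤ.* g 0 ℤ.+ 0ℤ) ℤ.* h (suc n) ℤ.+ z)
         (trans (*ₛ-distribʳ h f0g′ (f′ *ₛ g) n)
                (cong₂ ℤ._+_ (scale-*ₛ (f 0) g′ h n) (*ₛ-assoc f′ g h n))) ⟩
  (f 0 ℤ.* g 0 ℤ.+ 0ℤ) ℤ.* h (suc n) ℤ.+ (f 0 ℤ.* (g′ *ₛ h) n ℤ.+ (f′ *ₛ (g *ₛ h)) n)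
    ≡⟨ lemma (f 0) (g 0) (h (suc n)) ((g′ *ₛ h) n) ((f′ *ₛ (g *ₛ h)) n) ⟩
  f 0 ℤ.* (g 0 ℤ.* h (suc n) ℤ.+ (g′ *ₛ h) n) ℤ.+ (f′ *ₛ (g *ₛ h)) n ∎
  where
  open ≡-Reasoning
  f′ = f ∘ suc
  g′ = g ∘ suc
  f0g′ : Series
  f0g′ k = f 0 ℤ.* g′ k
  lemma : ∀ a b c x y → (a ℤ.* b ℤ.+ 0ℤ) ℤ.* c ℤ.+ (a ℤ.* x ℤ.+ y) ≡ a ℤ.* (b ℤ.* c ℤ.+ x) ℤ.+ y
  lemma = solve-∀

-- The mirror image of the defining recursion: the last summand is split off instead of the first.
-- Comparing the two recursions gives commutativity.
*ₛ-suc : ∀ f g n → (f *ₛ g) (suc n) ≡ g 0 ℤ.* f (suc n) ℤ.+ (f *ₛ (g ∘ suc)) n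
*ₛ-suc f g zero = lemma (f 0) (g 1) (f 1) (g 0)
  where
  lemma : ∀ a b c d → a ℤ.* b ℤ.+ (c ℤ.* d ℤ.+ 0ℤ) ≡ d ℤ.* c ℤ.+ (a ℤ.* b ℤ.+ 0ℤ)
  lemma = solve-∀
*ₛ-suc f g (suc n) =
  trans (cong (λ z → f 0 ℤ.* g (suc (suc n)) ℤ.+ z) (*ₛ-suc (f ∘ suc) g n))
        (lemma (f 0 ℤ.* g (suc (suc n))) (g 0 ℤ.* f (suc (suc n))) (((f ∘ suc) *ₛ (g ∘ suc)) n))
  where
  lemma : ∀ a b c → a ℤ.+ (b ℤ.+ c) ≡ b ℤ.+ (a ℤ.+ c)
  lemma = solve-∀

*ₛ-comm : ∀ f g → f *ₛ g ≈ₛ g *ₛ f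
*ₛ-comm f g zero    = cong (ℤ._+ 0ℤ) (ℤP.*-comm (f 0) (g 0))
*ₛ-comm f g (suc n) =
  trans (cong (λ z → f 0 ℤ.* g (suc n) ℤ.+ z) (*ₛ-comm (f ∘ suc) g n)) (sym (*ₛ-suc g f n))

series-commutativeRing : CommutativeRing 0ℓ 0ℓ
series-commutativeRing = record
  { Carrier = Series ; _≈_ = _≈ₛ_ ; _+_ = _+ₛ_ ; _*_ = _*ₛ_ ; -_ = -ₛ_ ; 0# = 0ₛ ; 1# = 1ₛ
  ; isCommutativeRing = record
    { isRing = record
      { +-isAbelianGroup = record
        { isGroup = record
          { isMonoid = record
            { isSemigroup = record
              { isMagma = record
                { isEquivalence = record
                  { refl  = λ _ → refl
                  ; sym   = λ f≈g k → sym (f≈g k)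
                  ; trans = λ f≈g g≈h k → trans (f≈g k) (g≈h k)
                  }
                ; ∙-cong = λ f≈f′ g≈g′ k → cong₂ ℤ._+_ (f≈f′ k) (g≈g′ k)
                }
              ; assoc = λ f g h k → ℤP.+-assoc (f k) (g k) (h k)
              }
            ; identity = (λ f k → ℤP.+-identityˡ (f k)) , λ f k → ℤP.+-identityʳ (f k)
            }
          ; inverse = (λ f k → ℤP.+-inverseˡ (f k)) , λ f k → ℤP.+-inverseʳ (f k)
          ; ⁻¹-cong = λ f≈g k → cong ℤ.-_ (f≈g k)
          }
        ; comm = λ f g k → ℤP.+-comm (f k) (g k)
        }
      ; *-cong     = *ₛ-cong
      ; *-assoc    = *ₛ-assoc
      ; *-identity = *ₛ-identityˡ , λ f k → trans (*ₛ-comm f 1ₛ k) (*ₛ-identityˡ f k)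
      ; distrib    = (λ f g h k → trans (*ₛ-comm f (g +ₛ h) k)
                        (trans (*ₛ-distribʳ f g h k) (cong₂ ℤ._+_ (*ₛ-comm g f k) (*ₛ-comm h f k))))
                   , *ₛ-distribʳ
      }
    ; *-comm = *ₛ-comm
    }
  }

q^ₛ-shift : ∀ p f n → (q ^ₛ p *ₛ f) (p + n) ≡ f n
q^ₛ-shift zero    f n = *ₛ-identityˡ f n
q^ₛ-shift (suc p) f n =
  trans (*ₛ-assoc q (q ^ₛ p) f (suc (p + n)))
    -- `q` has constant term 0 and its tail is `1ₛ`, so multiplication by `q` moves every
    -- coefficient up by one place.
    (trans (ℤP.+-identityˡ _) (trans (lemma (q ^ₛ p *ₛ f) (p + n)) (q^ₛ-shift p f n)))
  where
  lemma : ∀ g m → ((q ∘ suc) *ₛ g) m ≡ g m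
  lemma g m = trans (*ₛ-cong {q ∘ suc} {1ₛ} {g} {g} (λ { zero → refl ; (suc _) → refl }) (λ _ → refl) m) (*ₛ-identityˡ g m)

-- Weighted enumeration of partitions

-- The Iverson bracket. It turns the length of a filtered list into a weighted sum and a conjunction
-- into a product, so that independent conditions on part sizes become factors.
⟦_⟧ : ∀ {P : Set} → Dec P → ℤ
⟦ P? ⟧ = if does P? then 1ℤ else 0ℤ

⟦⟧-true : ∀ {P : Set} (P? : Dec P) → P → ⟦ P? ⟧ ≡ 1ℤ
⟦⟧-true P? p = cong (if_then 1ℤ else 0ℤ) (dec-true P? p)

⟦⟧-false : ∀ {P : Set} (P? : Dec P) → ¬ P → ⟦ P? ⟧ ≡ 0ℤ
⟦⟧-false P? ¬p = cong (if_then 1ℤ else 0ℤ) (dec-false P? ¬p)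

⟦⟧-cong : ∀ {P Q : Set} → P ⇔ Q → (P? : Dec P) (Q? : Dec Q) → ⟦ P? ⟧ ≡ ⟦ Q? ⟧
⟦⟧-cong P⇔Q P? Q? = cong (if_then 1ℤ else 0ℤ) (does-⇔ P⇔Q P? Q?)

⟦⟧-× : ∀ {P Q : Set} (P? : Dec P) (Q? : Dec Q) → ⟦ P? ×-dec Q? ⟧ ≡ ⟦ P? ⟧ ℤ.* ⟦ Q? ⟧
⟦⟧-× (true  because _) Q? = sym (ℤP.*-identityˡ ⟦ Q? ⟧)
⟦⟧-× (false because _) Q? = sym (ℤP.*-zeroˡ ⟦ Q? ⟧)

module _ {A : Set} where

  ∑ₗ : (A → ℤ) → List A → ℤ
  ∑ₗ w []       = 0ℤ
  ∑ₗ w (x ∷ xs) = w x ℤ.+ ∑ₗ w xs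

  ∑ₗ-cong : ∀ {w w′} xs → (∀ {x} → x ∈ xs → w x ≡ w′ x) → ∑ₗ w xs ≡ ∑ₗ w′ xs
  ∑ₗ-cong []       w≡w′ = refl
  ∑ₗ-cong (x ∷ xs) w≡w′ = cong₂ ℤ._+_ (w≡w′ (here refl)) (∑ₗ-cong xs (w≡w′ ∘ there))

  ∑ₗ-++ : ∀ w xs ys → ∑ₗ w (xs ++ ys) ≡ ∑ₗ w xs ℤ.+ ∑ₗ w ys
  ∑ₗ-++ w []       ys = sym (ℤP.+-identityˡ (∑ₗ w ys))
  ∑ₗ-++ w (x ∷ xs) ys =
    trans (cong (λ z → w x ℤ.+ z) (∑ₗ-++ w xs ys)) (sym (ℤP.+-assoc (w x) (∑ₗ w xs) (∑ₗ w ys)))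

  ∑ₗ-zero : ∀ {w : A → ℤ} xs → (∀ {x} → x ∈ xs → w x ≡ 0ℤ) → ∑ₗ w xs ≡ 0ℤ
  ∑ₗ-zero []       w≡0 = refl
  ∑ₗ-zero (x ∷ xs) w≡0 = cong₂ ℤ._+_ (w≡0 (here refl)) (∑ₗ-zero xs (w≡0 ∘ there))

  ∑ₗ-+ : ∀ w w′ xs → ∑ₗ (λ x → w x ℤ.+ w′ x) xs ≡ ∑ₗ w xs ℤ.+ ∑ₗ w′ xs
  ∑ₗ-+ w w′ []       = refl
  ∑ₗ-+ w w′ (x ∷ xs) =
    trans (cong (λ z → (w x ℤ.+ w′ x) ℤ.+ z) (∑ₗ-+ w w′ xs)) (lemma (w x) (w′ x) (∑ₗ w xs) (∑ₗ w′ xs))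
    where
    lemma : ∀ a b c d → (a ℤ.+ b) ℤ.+ (c ℤ.+ d) ≡ (a ℤ.+ c) ℤ.+ (b ℤ.+ d)
    lemma = solve-∀

  ∑ₗ-scale : ∀ a w xs → ∑ₗ (λ x → a ℤ.* w x) xs ≡ a ℤ.* ∑ₗ w xs
  ∑ₗ-scale a w []       = sym (ℤP.*-zeroʳ a)
  ∑ₗ-scale a w (x ∷ xs) =
    trans (cong (λ z → a ℤ.* w x ℤ.+ z) (∑ₗ-scale a w xs)) (sym (ℤP.*-distribˡ-+ a (w x) (∑ₗ w xs)))

  length-filter : ∀ {P : A → Set} (P? : ∀ x → Dec (P x)) xs →
                  ℤ.+ length (filter P? xs) ≡ ∑ₗ (λ x → ⟦ P? x ⟧) xs
  length-filter P? []       = refl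
  length-filter P? (x ∷ xs) with does (P? x)
  ... | true  = cong (λ z → 1ℤ ℤ.+ z) (length-filter P? xs)
  ... | false = trans (length-filter P? xs) (sym (ℤP.+-identityˡ _))

  ∑ₗ-filter : ∀ {P : A → Set} (P? : ∀ x → Dec (P x)) w xs →
              ∑ₗ w (filter P? xs) ≡ ∑ₗ (λ x → ⟦ P? x ⟧ ℤ.* w x) xs
  ∑ₗ-filter P? w []       = refl
  ∑ₗ-filter P? w (x ∷ xs) with does (P? x)
  ... | true  = cong₂ ℤ._+_ (sym (ℤP.*-identityˡ (w x))) (∑ₗ-filter P? w xs)
  ... | false = trans (∑ₗ-filter P? w xs)
                      (sym (trans (cong (ℤ._+ ∑ₗ (λ y → ⟦ P? y ⟧ ℤ.* w y) xs) (ℤP.*-zeroˡ (w x))) (ℤP.+-identityˡ _)))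

module _ {A B : Set} where

  ∑ₗ-map : ∀ (w : B → ℤ) (f : A → B) xs → ∑ₗ w (map f xs) ≡ ∑ₗ (w ∘ f) xs
  ∑ₗ-map w f []       = refl
  ∑ₗ-map w f (x ∷ xs) = cong (λ z → w (f x) ℤ.+ z) (∑ₗ-map w f xs)

  ∑ₗ-concatMap : ∀ (w : B → ℤ) (f : A → List B) xs → ∑ₗ w (concatMap f xs) ≡ ∑ₗ (λ x → ∑ₗ w (f x)) xs
  ∑ₗ-concatMap w f []       = refl
  ∑ₗ-concatMap w f (x ∷ xs) =
    trans (∑ₗ-++ w (f x) (concatMap f xs)) (cong (λ z → ∑ₗ w (f x) ℤ.+ z) (∑ₗ-concatMap w f xs))

  ∑ₗ-swap : ∀ (w : A → B → ℤ) xs ys →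
            ∑ₗ (λ x → ∑ₗ (w x) ys) xs ≡ ∑ₗ (λ y → ∑ₗ (λ x → w x y) xs) ys
  ∑ₗ-swap w []       ys = sym (∑ₗ-zero ys (λ _ → refl))
  ∑ₗ-swap w (x ∷ xs) ys =
    trans (cong (λ z → ∑ₗ (w x) ys ℤ.+ z) (∑ₗ-swap w xs ys))
          (sym (∑ₗ-+ (w x) (λ y → ∑ₗ (λ x′ → w x′ y) xs) ys))

partialSum-upTo : ∀ F N k → partialSum F N k ≡ ∑ₗ (λ j → F j k) (upTo N)
partialSum-upTo F zero    k = refl
partialSum-upTo F (suc N) k = begin
  partialSum F N k ℤ.+ F N k                            ≡⟨ cong₂ ℤ._+_ (partialSum-upTo F N k) (sym (ℤP.+-identityʳ (F N k))) ⟩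
  ∑ₗ (λ j → F j k) (upTo N) ℤ.+ ∑ₗ (λ j → F j k) (N ∷ []) ≡⟨ ∑ₗ-++ (λ j → F j k) (upTo N) (N ∷ []) ⟨
  ∑ₗ (λ j → F j k) (upTo N ++ N ∷ [])                   ≡⟨ cong (∑ₗ (λ j → F j k)) (List.upTo-∷ʳ N) ⟩
  ∑ₗ (λ j → F j k) (upTo (suc N))                       ∎
  where open ≡-Reasoning

-- Partitions with restricted multiplicities.

multiplicity-∉ : ∀ {p λs} → p ∉ λs → multiplicity p λs ≡ 0
multiplicity-∉ {p} p∉ = cong length (List.filter-none (p ≟_) (¬Any⇒All¬ _ p∉))

multiplicity-∈ : ∀ {p λs} → p ∈ λs → 1 ≤ multiplicity p λs
multiplicity-∈ {p} p∈ = List.filter-some (p ≟_) p∈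

multiplicity-replicate-self : ∀ k p {ys} → p ∉ ys → multiplicity p (replicate k p ++ ys) ≡ k
multiplicity-replicate-self zero    p p∉ = multiplicity-∉ p∉
multiplicity-replicate-self (suc k) p {ys} p∉ =
  trans (cong length (List.filter-accept (p ≟_) {xs = replicate k p ++ ys} refl)) (cong suc (multiplicity-replicate-self k p p∉))

multiplicity-replicate-other : ∀ k {p r} ys → p ≢ r → multiplicity p (replicate k r ++ ys) ≡ multiplicity p ys
multiplicity-replicate-other zero    ys p≢r = refl
multiplicity-replicate-other (suc k) {p} {r} ys p≢r =
  trans (cong length (List.filter-reject (p ≟_) {xs = replicate k r ++ ys} p≢r)) (multiplicity-replicate-other k ys p≢r)

module _ {R : ℕ → ℕ → Set} (R? : ∀ p k → Dec (R p k)) where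

  -- The recursion matches that of `boundedPartitions`, so each new part size splits off one
  -- condition. Sizes that do not occur are tested too, with multiplicity 0.
  Multiplicities : ℕ → List ℕ → Set
  Multiplicities zero    λs = ⊤
  Multiplicities (suc m) λs = R (suc m) (multiplicity (suc m) λs) × Multiplicities m λs

  multiplicities? : ∀ m λs → Dec (Multiplicities m λs)
  multiplicities? zero    λs = yes tt
  multiplicities? (suc m) λs = R? (suc m) (multiplicity (suc m) λs) ×-dec multiplicities? m λs

  multiplicities⁺ : ∀ m λs → (∀ p → 1 ≤ p → p ≤ m → R p (multiplicity p λs)) → Multiplicities m λs
  multiplicities⁺ zero    λs r = tt
  multiplicities⁺ (suc m) λs r =
    r (suc m) (s≤s z≤n) ℕP.≤-refl , multiplicities⁺ m λs (λ p 1≤p p≤m → r p 1≤p (ℕP.m≤n⇒m≤1+n p≤m))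

  multiplicities⁻ : ∀ m λs → Multiplicities m λs → ∀ p → 1 ≤ p → p ≤ m → R p (multiplicity p λs)
  multiplicities⁻ zero    λs _       p 1≤p p≤0 = contradiction (ℕP.≤-trans 1≤p p≤0) λ ()
  multiplicities⁻ (suc m) λs (r , rs) p 1≤p p≤1+m with p ≟ suc m
  ... | yes refl = r
  ... | no p≢1+m = multiplicities⁻ m λs rs p 1≤p (ℕP.≤-pred (ℕP.≤∧≢⇒< p≤1+m p≢1+m))

  -- Since `suc m` does not occur in `ys`, the prepended copies give it multiplicity exactly `k` and
  -- leave the multiplicities of all smaller sizes unchanged.
  weight-replicate : ∀ m k ys → All (_≤ m) ys →
    ⟦ multiplicities? (suc m) (replicate k (suc m) ++ ys) ⟧ ≡ ⟦ R? (suc m) k ⟧ ℤ.* ⟦ multiplicities? m ys ⟧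
  weight-replicate m k ys ys≤m = trans
    (⟦⟧-× (R? (suc m) (multiplicity (suc m) (replicate k (suc m) ++ ys))) (multiplicities? m (replicate k (suc m) ++ ys)))
    (cong₂ ℤ._*_
      (cong (λ j → ⟦ R? (suc m) j ⟧)
        (multiplicity-replicate-self k (suc m) (λ 1+m∈ → ℕP.<⇒≱ (ℕP.n<1+n m) (All.lookup ys≤m 1+m∈))))
      (lower m ℕP.≤-refl))
    where
    -- The block of copies of `suc m` stays fixed while the induction descends through the smaller
    -- sizes `l`.
    lower : ∀ l → l ≤ m → ⟦ multiplicities? l (replicate k (suc m) ++ ys) ⟧ ≡ ⟦ multiplicities? l ys ⟧
    lower zero    l≤m = refl
    lower (suc l) l<m = begin
      ⟦ multiplicities? (suc l) (replicate k (suc m) ++ ys) ⟧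
        ≡⟨ ⟦⟧-× (R? (suc l) (multiplicity (suc l) (replicate k (suc m) ++ ys))) (multiplicities? l (replicate k (suc m) ++ ys)) ⟩
      ⟦ R? (suc l) (multiplicity (suc l) (replicate k (suc m) ++ ys)) ⟧ ℤ.* ⟦ multiplicities? l (replicate k (suc m) ++ ys) ⟧
        ≡⟨ cong₂ ℤ._*_ (cong (λ j → ⟦ R? (suc l) j ⟧) (multiplicity-replicate-other k ys (ℕP.<⇒≢ (s≤s l<m)))) (lower l (ℕP.<⇒≤ l<m)) ⟩
      ⟦ R? (suc l) (multiplicity (suc l) ys) ⟧ ℤ.* ⟦ multiplicities? l ys ⟧
        ≡⟨ ⟦⟧-× (R? (suc l) (multiplicity (suc l) ys)) (multiplicities? l ys) ⟨
      ⟦ multiplicities? (suc l) ys ⟧ ∎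
      where open ≡-Reasoning

  restrictedCount : ℕ → Series
  restrictedCount m n = ∑ₗ (λ λs → ⟦ multiplicities? m λs ⟧) (boundedPartitions m n)

-- copies m a g  is  (a₀ + a₁ qᵐ⁺¹ + a₂ q²⁽ᵐ⁺¹⁾ + ⋯) g
copies : ℕ → (ℕ → ℤ) → Series → Series
copies m a g n = ∑ₗ (λ k → a k ℤ.* g (n ∸ k * suc m)) (upTo (suc (n / suc m)))

-- `boundedPartitions` is sorted by the number `k` of copies of the largest size, and by
-- `weight-replicate` the condition at that size depends on `k` alone.
restrictedCount-suc : ∀ {R : ℕ → ℕ → Set} (R? : ∀ p k → Dec (R p k)) m →
  restrictedCount R? (suc m) ≈ₛ copies m (λ k → ⟦ R? (suc m) k ⟧) (restrictedCount R? m)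
restrictedCount-suc R? m n = trans
  (∑ₗ-concatMap w (withCopies m n) (upTo (suc (n / suc m))))
  (∑ₗ-cong (upTo (suc (n / suc m))) λ {k} _ → begin
    ∑ₗ w (withCopies m n k)
      ≡⟨ ∑ₗ-map w (replicate k (suc m) ++_) (boundedPartitions m (n ∸ k * suc m)) ⟩
    ∑ₗ (λ ys → w (replicate k (suc m) ++ ys)) (boundedPartitions m (n ∸ k * suc m))
      ≡⟨ ∑ₗ-cong (boundedPartitions m (n ∸ k * suc m)) (λ {ys} ys∈ →
           weight-replicate R? m k ys (proj₂ (boundedPartitions-sound m (n ∸ k * suc m) ys∈))) ⟩
    ∑ₗ (λ ys → ⟦ R? (suc m) k ⟧ ℤ.* ⟦ multiplicities? R? m ys ⟧) (boundedPartitions m (n ∸ k * suc m))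
      ≡⟨ ∑ₗ-scale ⟦ R? (suc m) k ⟧ (λ ys → ⟦ multiplicities? R? m ys ⟧) (boundedPartitions m (n ∸ k * suc m)) ⟩
    ⟦ R? (suc m) k ⟧ ℤ.* restrictedCount R? m (n ∸ k * suc m) ∎)
  where
  open ≡-Reasoning
  w = λ λs → ⟦ multiplicities? R? (suc m) λs ⟧

-- A part size larger than `n` cannot occur: the quotient is 0, which leaves only `k = 0`. One part
-- bound can therefore serve all small coefficients.
boundedPartitions-+ : ∀ d n → boundedPartitions (d + n) n ≡ partitions n
boundedPartitions-+ zero    n = refl
boundedPartitions-+ (suc d) n
  rewrite m<n⇒m/n≡0 {n} {suc (d + n)} (s≤s (ℕP.m≤n+m n d)) =
  trans (List.++-identityʳ _) (trans (List.map-id _) (boundedPartitions-+ d n))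

boundedPartitions-≥ : ∀ {m n} → n ≤ m → boundedPartitions m n ≡ partitions n
boundedPartitions-≥ {m} {n} n≤m =
  trans (cong (λ l → boundedPartitions l n) (sym (ℕP.m∸n+n≡m n≤m))) (boundedPartitions-+ (m ∸ n) n)

-- Partitions with prescribed mex

Allowed : (t p k : ℕ) → Set
Allowed t p k = (p < t → 1 ≤ k) × (p ≡ t → k ≡ 0) × (2 ∣ p → k ≤ 1)

allowed? : ∀ t p k → Dec (Allowed t p k)
allowed? t p k = (p <? t →-dec 1 ≤? k) ×-dec (p ≟ t →-dec k ≟ 0) ×-dec (2 ∣? p →-dec k ≤? 1)

mex-unique : ∀ {λs s t} → IsMex λs s → IsMex λs t → s ≡ t
mex-unique {_} {s} {t} (1≤s , s∉ , <s) (1≤t , t∉ , <t) with ℕP.<-cmp s t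
... | tri< s<t _ _ = contradiction (<t s 1≤s s<t) s∉
... | tri≈ _ s≡t _ = s≡t
... | tri> _ _ t<s = contradiction (<s t 1≤t t<s) t∉

mex≤1+sum : ∀ λs → mex λs ≤ suc (sum λs)
mex≤1+sum λs = ℕP.≮⇒≥ λ 1+sum<mex →
  ℕP.<⇒≱ (ℕP.n<1+n (sum λs)) (All.lookup (parts≤sum λs) (proj₂ (proj₂ (mex-isMex λs)) _ (s≤s z≤n) 1+sum<mex))

-- The bound `M` has to cover both `t` and all parts: only then does the test reach every size up to
-- the mex and every even part.
allowed⇔mex : ∀ {M t λs} → 1 ≤ t → t ≤ M → All (1 ≤_) λs → All (_≤ M) λs →
  Multiplicities (allowed? t) M λs ⇔ (EvenPartsDistinct λs × mex λs ≡ t)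
allowed⇔mex {M} {t} {λs} 1≤t t≤M pos bnd = mk⇔ to from
  where
  to : Multiplicities (allowed? t) M λs → EvenPartsDistinct λs × mex λs ≡ t
  to ms = All.tabulate (λ {p} p∈ → proj₂ (proj₂ (allowed p (All.lookup pos p∈) (All.lookup bnd p∈))))
        , mex-unique (mex-isMex λs) (1≤t , t∉ , <t)
    where
    allowed = multiplicities⁻ (allowed? t) M λs ms
    t∉ : t ∉ λs
    t∉ t∈ = ℕP.<⇒≢ (multiplicity-∈ t∈) (sym (proj₁ (proj₂ (allowed t 1≤t t≤M)) refl))
    <t : ∀ j → 1 ≤ j → j < t → j ∈ λs
    <t j 1≤j j<t with j ∈? λs
    ... | yes j∈ = j∈
    ... | no  j∉ = contradiction (sym (multiplicity-∉ j∉))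
                     (ℕP.<⇒≢ (proj₁ (allowed j 1≤j (ℕP.<⇒≤ (ℕP.<-≤-trans j<t t≤M))) j<t))
  from : EvenPartsDistinct λs × mex λs ≡ t → Multiplicities (allowed? t) M λs
  from (epd , refl) = multiplicities⁺ (allowed? t) M λs λ p 1≤p p≤M →
      (λ p<t → multiplicity-∈ (<mex p 1≤p p<t))
    , (λ { refl → multiplicity-∉ mex∉ })
    , at-most-once p
    where
    mex∉ = proj₁ (proj₂ (mex-isMex λs))
    <mex = proj₂ (proj₂ (mex-isMex λs))
    at-most-once : ∀ p → 2 ∣ p → multiplicity p λs ≤ 1
    -- `EvenPartsDistinct` speaks only of sizes that occur; an absent size has multiplicity 0.
    at-most-once p 2∣p with p ∈? λs
    ... | yes p∈ = All.lookup epd p∈ 2∣p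
    ... | no  p∉ = ℕP.≤-trans (ℕP.≤-reflexive (multiplicity-∉ p∉)) z≤n

-- The positive integers ≡ b + 1 (mod 2), for b < 2.
target : ℕ → ℕ → ℕ
target b j = suc (b + j * 2)

target-injective : ∀ b {i j} → target b i ≡ target b j → i ≡ j
target-injective b {i} {j} eq = ℕP.*-cancelʳ-≡ i j 2 (ℕP.+-cancelˡ-≡ b (i * 2) (j * 2) (ℕP.suc-injective eq))

target-parity : ∀ b j → target b j % 2 ≡ suc b % 2
target-parity b j = [m+kn]%n≡m%n (suc b) j 2

target-surjective : ∀ {b x} → b < 2 → 1 ≤ x → x % 2 ≡ suc b % 2 → ∃ λ j → x ≡ target b j
-- For `x = suc y`, the parity condition forces the remainder of `y` modulo 2 to be `b`; the
-- quotient is the index.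
target-surjective {b} {suc y} b<2 _ eq = y / 2 ,
  cong suc (trans (m≡m%n+[m/n]*n y 2) (cong (_+ y / 2 * 2) (residue (y % 2) b (m%n<n y 2) b<2 eq′)))
  where
  eq′ : suc (y % 2) % 2 ≡ suc b % 2
  eq′ = trans (sym ([m+kn]%n≡m%n (suc (y % 2)) (y / 2) 2)) (trans (cong (λ z → suc z % 2) (sym (m≡m%n+[m/n]*n y 2))) eq)
  residue : ∀ r b → r < 2 → b < 2 → suc r % 2 ≡ suc b % 2 → r ≡ b
  residue 0 0 _ _ _ = refl
  residue 1 1 _ _ _ = refl
  residue (suc (suc _)) _ (s≤s (s≤s ())) _ _
  residue _ (suc (suc _)) _ (s≤s (s≤s ())) _

target-≤ : ∀ {b j L} → b < 2 → j < L → target b j ≤ L * 2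
target-≤ {b} {j} b<2 j<L = ℕP.≤-trans (ℕP.+-monoˡ-≤ (j * 2) b<2) (ℕP.*-monoˡ-≤ 2 j<L)

index-< : ∀ b j → j < target b j
index-< b j = s≤s (ℕP.≤-trans (ℕP.m≤m*n j 2) (ℕP.m≤n+m (j * 2) b))

∑-indicator : ∀ b i xs → Unique xs → i ∈ xs → ∑ₗ (λ j → ⟦ target b i ≟ target b j ⟧) xs ≡ 1ℤ
∑-indicator b i (.i ∷ xs) (i∉ ∷ _) (here refl) = cong₂ ℤ._+_
  (⟦⟧-true (target b i ≟ target b i) refl)
  (∑ₗ-zero xs (λ {j} j∈ → ⟦⟧-false (target b i ≟ target b j) (λ eq → All.lookup i∉ j∈ (target-injective b eq))))
∑-indicator b i (x ∷ xs) (x∉ ∷ u) (there i∈) = cong₂ ℤ._+_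
  (⟦⟧-false (target b i ≟ target b x) (λ eq → All.lookup x∉ i∈ (sym (target-injective b eq))))
  (∑-indicator b i xs u i∈)

-- At most one `j` contributes, because `target b` is injective. The indices below `L` suffice
-- because `j < target b j`, which is `x`.
parity-decomposition : ∀ {b L x} → b < 2 → 1 ≤ x → x ≤ L →
  ⟦ x % 2 ≟ suc b % 2 ⟧ ≡ ∑ₗ (λ j → ⟦ x ≟ target b j ⟧) (upTo L)
parity-decomposition {b} {L} {x} b<2 1≤x x≤L with x % 2 ≟ suc b % 2
... | no x≢ = trans (⟦⟧-false (x % 2 ≟ suc b % 2) x≢) (sym (∑ₗ-zero (upTo L) λ {j} _ →
        ⟦⟧-false (x ≟ target b j) λ { refl → x≢ (target-parity b j) }))
... | yes x≡ with target-surjective b<2 1≤x x≡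
...   | i , refl = trans (⟦⟧-true (target b i % 2 ≟ suc b % 2) x≡)
        (sym (∑-indicator b i (upTo L) (Unique.upTo⁺ L) (∈-upTo⁺ (ℕP.<-≤-trans (index-< b i) x≤L))))

countByMexParity : ℕ → ℕ → ℕ
countByMexParity r n = length (filter (λ λs → mex λs % 2 ≟ r) (Ped n))

-- A partition of `k` has mex at most `k + 1`, hence at most `L`, so the indices `j < L` capture its
-- mex. The part bound `L * 2` covers each `target b j` with `j < L` as well as all partitions of
-- `k`.
countByMexParity-decomposition : ∀ {b} → b < 2 → ∀ {L k} → k < L →
  ℤ.+ countByMexParity (suc b % 2) k ≡ partialSum (λ j → restrictedCount (allowed? (target b j)) (L * 2)) L k
countByMexParity-decomposition {b} b<2 {L} {k} k<L = begin
  ℤ.+ countByMexParity (suc b % 2) k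
    ≡⟨ length-filter (λ λs → mex λs % 2 ≟ suc b % 2) (Ped k) ⟩
  ∑ₗ (λ λs → ⟦ mex λs % 2 ≟ suc b % 2 ⟧) (Ped k)
    ≡⟨ ∑ₗ-filter evenPartsDistinct? (λ λs → ⟦ mex λs % 2 ≟ suc b % 2 ⟧) (partitions k) ⟩
  ∑ₗ (λ λs → ⟦ evenPartsDistinct? λs ⟧ ℤ.* ⟦ mex λs % 2 ≟ suc b % 2 ⟧) (partitions k)
    ≡⟨ cong (∑ₗ _) (boundedPartitions-≥ (ℕP.≤-trans (ℕP.<⇒≤ k<L) (ℕP.m≤m*n L 2))) ⟨
  ∑ₗ (λ λs → ⟦ evenPartsDistinct? λs ⟧ ℤ.* ⟦ mex λs % 2 ≟ suc b % 2 ⟧) (boundedPartitions (L * 2) k)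
    ≡⟨ ∑ₗ-cong (boundedPartitions (L * 2) k) pointwise ⟩
  ∑ₗ (λ λs → ∑ₗ (λ j → ⟦ multiplicities? (allowed? (target b j)) (L * 2) λs ⟧) (upTo L)) (boundedPartitions (L * 2) k)
    ≡⟨ ∑ₗ-swap (λ λs j → ⟦ multiplicities? (allowed? (target b j)) (L * 2) λs ⟧) (boundedPartitions (L * 2) k) (upTo L) ⟩
  ∑ₗ (λ j → restrictedCount (allowed? (target b j)) (L * 2) k) (upTo L)
    ≡⟨ partialSum-upTo (λ j → restrictedCount (allowed? (target b j)) (L * 2)) L k ⟨
  partialSum (λ j → restrictedCount (allowed? (target b j)) (L * 2)) L k ∎
  where
  open ≡-Reasoning
  pointwise : ∀ {λs} → λs ∈ boundedPartitions (L * 2) k →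
    ⟦ evenPartsDistinct? λs ⟧ ℤ.* ⟦ mex λs % 2 ≟ suc b % 2 ⟧ ≡
    ∑ₗ (λ j → ⟦ multiplicities? (allowed? (target b j)) (L * 2) λs ⟧) (upTo L)
  pointwise {λs} λs∈ with boundedPartitions-sound (L * 2) k λs∈
  ... | (_ , pos , refl) , bnd = begin
    ⟦ evenPartsDistinct? λs ⟧ ℤ.* ⟦ mex λs % 2 ≟ suc b % 2 ⟧
      ≡⟨ cong (⟦ evenPartsDistinct? λs ⟧ ℤ.*_)
           (parity-decomposition b<2 (proj₁ (mex-isMex λs)) (ℕP.≤-trans (mex≤1+sum λs) k<L)) ⟩
    ⟦ evenPartsDistinct? λs ⟧ ℤ.* ∑ₗ (λ j → ⟦ mex λs ≟ target b j ⟧) (upTo L)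
      ≡⟨ ∑ₗ-scale ⟦ evenPartsDistinct? λs ⟧ (λ j → ⟦ mex λs ≟ target b j ⟧) (upTo L) ⟨
    ∑ₗ (λ j → ⟦ evenPartsDistinct? λs ⟧ ℤ.* ⟦ mex λs ≟ target b j ⟧) (upTo L)
      ≡⟨ ∑ₗ-cong (upTo L) (λ {j} j∈ → trans
           (sym (⟦⟧-× (evenPartsDistinct? λs) (mex λs ≟ target b j)))
           (sym (⟦⟧-cong (allowed⇔mex (s≤s z≤n) (target-≤ b<2 (∈-upTo⁻ j∈)) pos bnd)
                         (multiplicities? (allowed? (target b j)) (L * 2) λs)
                         (evenPartsDistinct? λs ×-dec (mex λs ≟ target b j))))) ⟩
    ∑ₗ (λ j → ⟦ multiplicities? (allowed? (target b j)) (L * 2) λs ⟧) (upTo L) ∎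

-- The factor contributed by a single part size

-- The term `k = 0` is split off. If `n < suc m` there is no other term, and the power of `q` kills
-- the remainder; otherwise the remaining terms, reindexed, form the same sum at `n ∸ suc m`.
copies-step : ∀ m a g → copies m a g ≈ₛ (λ n → a 0 ℤ.* g n) +ₛ q ^ₛ suc m *ₛ copies m (a ∘ suc) g
copies-step m a g n with ℕP.<-≤-connex n (suc m)
... | inj₁ n<p rewrite m<n⇒m/n≡0 n<p =
  cong (λ z → a 0 ℤ.* g n ℤ.+ z)
    (sym (Order≥-*ˡ (q ^ₛ suc m) (copies m (a ∘ suc) g) (Order≥-^ q refl (suc m)) n n<p))
... | inj₂ p≤n rewrite m/n≡1+[m∸n]/n p≤n = cong (λ z → a 0 ℤ.* g n ℤ.+ z) (begin
  ∑ₗ term (applyUpTo suc K)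
    ≡⟨ cong (∑ₗ term) (List.map-upTo suc K) ⟨
  ∑ₗ term (map suc (upTo K))
    ≡⟨ ∑ₗ-map term suc (upTo K) ⟩
  ∑ₗ (term ∘ suc) (upTo K)
    ≡⟨ ∑ₗ-cong (upTo K) (λ {k} _ → cong (λ z → a (suc k) ℤ.* g z) (sym (ℕP.∸-+-assoc n (suc m) (k * suc m)))) ⟩
  copies m (a ∘ suc) g (n ∸ suc m)
    ≡⟨ q^ₛ-shift (suc m) (copies m (a ∘ suc) g) (n ∸ suc m) ⟨
  (q ^ₛ suc m *ₛ copies m (a ∘ suc) g) (suc m + (n ∸ suc m))
    ≡⟨ cong (q ^ₛ suc m *ₛ copies m (a ∘ suc) g) (ℕP.m+[n∸m]≡n p≤n) ⟩
  (q ^ₛ suc m *ₛ copies m (a ∘ suc) g) n ∎)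
  where
  open ≡-Reasoning
  K = suc ((n ∸ suc m) / suc m)
  term : ℕ → ℤ
  term k = a k ℤ.* g (n ∸ k * suc m)

open CommutativeRing series-commutativeRing using (setoid; commutativeSemiring; ring)
  renaming ( refl to ≈ₛ-refl; sym to ≈ₛ-sym; trans to ≈ₛ-trans; reflexive to ≈ₛ-reflexive
           ; +-cong to +ₛ-cong; -‿cong to -ₛ-cong; *-congˡ to *ₛ-congˡ; *-congʳ to *ₛ-congʳ
           ; zeroʳ to *ₛ-zeroʳ; distribˡ to *ₛ-distribˡ )
open import Algebra.Properties.Ring ring using (-‿distribˡ-*; -‿involutive)
open import Algebra.Solver.Ring.NaturalCoefficients.Default commutativeSemiring using (solve; _:=_; _:*_)
open import Relation.Binary.Reasoning.Setoid setoid

-ₛ-distribʳ : ∀ h f g → (f -ₛ g) *ₛ h ≈ₛ f *ₛ h -ₛ g *ₛ h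
-ₛ-distribʳ h f g = begin
  (f +ₛ -ₛ g) *ₛ h     ≈⟨ *ₛ-distribʳ h f (-ₛ g) ⟩
  f *ₛ h +ₛ (-ₛ g) *ₛ h ≈⟨ +ₛ-cong {f *ₛ h} {f *ₛ h} ≈ₛ-refl (-‿distribˡ-* g h) ⟨
  f *ₛ h -ₛ g *ₛ h     ∎

*ₛ-cancelˡ : ∀ {D X Y} → D 0 ≡ 1ℤ → D *ₛ X ≈ₛ Y → X ≈ₛ Y /ₛ D
*ₛ-cancelˡ {D} {X} {Y} D₀≡1 DX≈Y = begin
  X                    ≈⟨ *ₛ-identityˡ X ⟨
  1ₛ *ₛ X              ≈⟨ *ₛ-congʳ {X} (recip-inverse D D₀≡1) ⟨
  (D *ₛ recip D) *ₛ X  ≈⟨ solve 3 (λ d r x → (d :* r) :* x := (d :* x) :* r) ≈ₛ-refl D (recip D) X ⟩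
  (D *ₛ X) *ₛ recip D  ≈⟨ *ₛ-congʳ {recip D} DX≈Y ⟩
  Y /ₛ D               ∎

^ₛ-+ : ∀ f m n → f ^ₛ (m + n) ≈ₛ f ^ₛ m *ₛ f ^ₛ n
^ₛ-+ f zero    n = ≈ₛ-sym (*ₛ-identityˡ (f ^ₛ n))
^ₛ-+ f (suc m) n = begin
  f *ₛ f ^ₛ (m + n)           ≈⟨ *ₛ-congˡ {f} (^ₛ-+ f m n) ⟩
  f *ₛ (f ^ₛ m *ₛ f ^ₛ n)     ≈⟨ *ₛ-assoc f (f ^ₛ m) (f ^ₛ n) ⟨
  f *ₛ f ^ₛ m *ₛ f ^ₛ n       ∎

q²^ₛ : ∀ n → q² ^ₛ n ≈ₛ q ^ₛ (n * 2)
q²^ₛ zero    = ≈ₛ-refl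
q²^ₛ (suc n) = begin
  q² *ₛ q² ^ₛ n      ≈⟨ *ₛ-congˡ {q²} (q²^ₛ n) ⟩
  q² *ₛ q ^ₛ (n * 2) ≈⟨ ^ₛ-+ q 2 (n * 2) ⟨
  q ^ₛ (suc n * 2)   ∎

copies-cong : ∀ m a a′ g → (∀ k → a k ≡ a′ k) → copies m a g ≈ₛ copies m a′ g
copies-cong m a a′ g a≡a′ n = ∑ₗ-cong (upTo (suc (n / suc m))) λ {k} _ → cong (ℤ._* g (n ∸ k * suc m)) (a≡a′ k)

copies-none : ∀ m a g → (∀ k → a k ≡ 0ℤ) → copies m a g ≈ₛ 0ₛ
copies-none m a g a≡0 n = ∑ₗ-zero (upTo (suc (n / suc m))) λ {k} _ →
  trans (cong (ℤ._* g (n ∸ k * suc m)) (a≡0 k)) (ℤP.*-zeroˡ (g (n ∸ k * suc m)))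

copies-step₀ : ∀ m a g → a 0 ≡ 0ℤ → copies m a g ≈ₛ q ^ₛ suc m *ₛ copies m (a ∘ suc) g
copies-step₀ m a g a₀≡0 n = trans (copies-step m a g n)
  (trans (cong (ℤ._+ (q ^ₛ suc m *ₛ copies m (a ∘ suc) g) n) (trans (cong (ℤ._* g n) a₀≡0) (ℤP.*-zeroˡ (g n)))) (ℤP.+-identityˡ _))

copies-step₁ : ∀ m a g → a 0 ≡ 1ℤ → copies m a g ≈ₛ g +ₛ q ^ₛ suc m *ₛ copies m (a ∘ suc) g
copies-step₁ m a g a₀≡1 n = trans (copies-step m a g n)
  (cong (ℤ._+ (q ^ₛ suc m *ₛ copies m (a ∘ suc) g) n) (trans (cong (ℤ._* g n) a₀≡1) (ℤP.*-identityˡ (g n))))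

copies-0 : ∀ m a g → a 0 ≡ 1ℤ → (∀ k → a (suc k) ≡ 0ℤ) → copies m a g ≈ₛ g
copies-0 m a g a₀≡1 a₊≡0 = begin
  copies m a g                                ≈⟨ copies-step₁ m a g a₀≡1 ⟩
  g +ₛ q ^ₛ suc m *ₛ copies m (a ∘ suc) g    ≈⟨ +ₛ-cong {g} {g} ≈ₛ-refl (*ₛ-congˡ {q ^ₛ suc m} (copies-none m (a ∘ suc) g a₊≡0)) ⟩
  g +ₛ q ^ₛ suc m *ₛ 0ₛ                      ≈⟨ +ₛ-cong {g} {g} ≈ₛ-refl (*ₛ-zeroʳ (q ^ₛ suc m)) ⟩
  g +ₛ 0ₛ                                     ≈⟨ (λ k → ℤP.+-identityʳ (g k)) ⟩
  g                                           ∎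

copies-1 : ∀ m a g → a 0 ≡ 0ℤ → a 1 ≡ 1ℤ → (∀ k → a (suc (suc k)) ≡ 0ℤ) → copies m a g ≈ₛ q ^ₛ suc m *ₛ g
copies-1 m a g a₀≡0 a₁≡1 a₂≡0 =
  ≈ₛ-trans (copies-step₀ m a g a₀≡0) (*ₛ-congˡ {q ^ₛ suc m} (copies-0 m (a ∘ suc) g a₁≡1 a₂≡0))

copies-≤1 : ∀ m a g → a 0 ≡ 1ℤ → a 1 ≡ 1ℤ → (∀ k → a (suc (suc k)) ≡ 0ℤ) → copies m a g ≈ₛ (1ₛ +ₛ q ^ₛ suc m) *ₛ g
copies-≤1 m a g a₀≡1 a₁≡1 a₂≡0 = begin
  copies m a g                              ≈⟨ copies-step₁ m a g a₀≡1 ⟩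
  g +ₛ q ^ₛ suc m *ₛ copies m (a ∘ suc) g  ≈⟨ +ₛ-cong {g} {g} ≈ₛ-refl (*ₛ-congˡ {q ^ₛ suc m} (copies-0 m (a ∘ suc) g a₁≡1 a₂≡0)) ⟩
  g +ₛ q ^ₛ suc m *ₛ g                     ≈⟨ +ₛ-cong (*ₛ-identityˡ g) ≈ₛ-refl ⟨
  1ₛ *ₛ g +ₛ q ^ₛ suc m *ₛ g               ≈⟨ *ₛ-distribʳ g 1ₛ (q ^ₛ suc m) ⟨
  (1ₛ +ₛ q ^ₛ suc m) *ₛ g                  ∎

-- The geometric series: a constant sequence equals its own tail, so `C` satisfies `C = g + Q C`.
copies-all : ∀ m a g → (∀ k → a k ≡ 1ℤ) → (1ₛ -ₛ q ^ₛ suc m) *ₛ copies m a g ≈ₛ g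
copies-all m a g a≡1 = begin
  (1ₛ -ₛ Q) *ₛ C            ≈⟨ -ₛ-distribʳ C 1ₛ Q ⟩
  1ₛ *ₛ C -ₛ Q *ₛ C         ≈⟨ +ₛ-cong {1ₛ *ₛ C} {C} { -ₛ (Q *ₛ C)} (*ₛ-identityˡ C) ≈ₛ-refl ⟩
  C -ₛ Q *ₛ C               ≈⟨ +ₛ-cong {C} {_} { -ₛ (Q *ₛ C)} (copies-step₁ m a g (a≡1 0)) ≈ₛ-refl ⟩
  g +ₛ Q *ₛ C′ -ₛ Q *ₛ C    ≈⟨ +ₛ-cong {_} {_} { -ₛ (Q *ₛ C)} (+ₛ-cong {g} {g} ≈ₛ-refl (*ₛ-congˡ {Q} (copies-cong m (a ∘ suc) a g λ k → trans (a≡1 (suc k)) (sym (a≡1 k))))) ≈ₛ-refl ⟩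
  g +ₛ Q *ₛ C -ₛ Q *ₛ C     ≈⟨ (λ k → lemma (g k) ((Q *ₛ C) k)) ⟩
  g                         ∎
  where
  Q = q ^ₛ suc m
  C = copies m a g
  C′ = copies m (a ∘ suc) g
  lemma : ∀ x y → x ℤ.+ y ℤ.- y ≡ x
  lemma = solve-∀

-- Excluding `k = 0` pulls one factor `Q` out of the geometric series.
copies-≥1 : ∀ m a g → a 0 ≡ 0ℤ → (∀ k → a (suc k) ≡ 1ℤ) →
            (1ₛ -ₛ q ^ₛ suc m) *ₛ copies m a g ≈ₛ q ^ₛ suc m *ₛ g
copies-≥1 m a g a₀≡0 a₊≡1 = begin
  D *ₛ copies m a g          ≈⟨ *ₛ-congˡ {D} (copies-step₀ m a g a₀≡0) ⟩
  D *ₛ (Q *ₛ C′)             ≈⟨ solve 3 (λ d x c → d :* (x :* c) := x :* (d :* c)) ≈ₛ-refl D Q C′ ⟩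
  Q *ₛ (D *ₛ C′)             ≈⟨ *ₛ-congˡ {Q} (copies-all m (a ∘ suc) g a₊≡1) ⟩
  Q *ₛ g                     ∎
  where
  Q = q ^ₛ suc m
  D = 1ₛ -ₛ Q
  C′ = copies m (a ∘ suc) g

-- `oddFactor p` clears the geometric series at an odd size; `evenFactor p` is what an even size
-- above the mex contributes.
oddFactor evenFactor : ℕ → Series
oddFactor  p = if does (2 ∣? p) then 1ₛ else 1ₛ -ₛ q ^ₛ p
evenFactor p = if does (2 ∣? p) then 1ₛ +ₛ q ^ₛ p else 1ₛ

oddFactor-even : ∀ {p} → 2 ∣ p → oddFactor p ≡ 1ₛ
oddFactor-even {p} 2∣p = cong (if_then 1ₛ else 1ₛ -ₛ q ^ₛ p) (dec-true (2 ∣? p) 2∣p)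

oddFactor-odd : ∀ {p} → ¬ 2 ∣ p → oddFactor p ≡ 1ₛ -ₛ q ^ₛ p
oddFactor-odd {p} 2∤p = cong (if_then 1ₛ else 1ₛ -ₛ q ^ₛ p) (dec-false (2 ∣? p) 2∤p)

evenFactor-even : ∀ {p} → 2 ∣ p → evenFactor p ≡ 1ₛ +ₛ q ^ₛ p
evenFactor-even {p} 2∣p = cong (if_then 1ₛ +ₛ q ^ₛ p else 1ₛ) (dec-true (2 ∣? p) 2∣p)

evenFactor-odd : ∀ {p} → ¬ 2 ∣ p → evenFactor p ≡ 1ₛ
evenFactor-odd {p} 2∤p = cong (if_then 1ₛ +ₛ q ^ₛ p else 1ₛ) (dec-false (2 ∣? p) 2∤p)

module _ (t m : ℕ) (g : Series) where
  private
    p = suc m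
    a : ℕ → ℤ
    a k = ⟦ allowed? t p k ⟧
    C = copies m a g

    a≡0 : ∀ k → ¬ Allowed t p k → a k ≡ 0ℤ
    a≡0 k = ⟦⟧-false (allowed? t p k)

    a≡1 : ∀ k → Allowed t p k → a k ≡ 1ℤ
    a≡1 k = ⟦⟧-true (allowed? t p k)

    2≰1 : ∀ {k} → ¬ suc (suc k) ≤ 1
    2≰1 (s≤s ())

  -- Both parities give the same result: an even size occurs exactly once, while an odd size gives a
  -- geometric series starting at `q ^ₛ p`, whose denominator is cleared.
  below-mex : p < t → oddFactor p *ₛ C ≈ₛ q ^ₛ p *ₛ g
  below-mex p<t = byParity (2 ∣? p)
    where
    p≢t : ∀ {k} → p ≡ t → k ≡ 0
    p≢t p≡t = contradiction p≡t (ℕP.<⇒≢ p<t)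
    a₀≡0 : a 0 ≡ 0ℤ
    a₀≡0 = a≡0 0 λ (positive , _) → contradiction (positive p<t) λ ()
    byParity : Dec (2 ∣ p) → oddFactor p *ₛ C ≈ₛ q ^ₛ p *ₛ g
    byParity (yes 2∣p) = begin
      oddFactor p *ₛ C ≈⟨ *ₛ-congʳ {C} (≈ₛ-reflexive (oddFactor-even 2∣p)) ⟩
      1ₛ *ₛ C          ≈⟨ *ₛ-identityˡ C ⟩
      C                ≈⟨ copies-1 m a g a₀≡0
                            (a≡1 1 ((λ _ → s≤s z≤n) , p≢t , λ _ → s≤s z≤n))
                            (λ k → a≡0 (suc (suc k)) λ (_ , _ , atMostOnce) → 2≰1 (atMostOnce 2∣p)) ⟩
      q ^ₛ p *ₛ g      ∎
    byParity (no 2∤p) = begin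
      oddFactor p *ₛ C    ≈⟨ *ₛ-congʳ {C} (≈ₛ-reflexive (oddFactor-odd 2∤p)) ⟩
      (1ₛ -ₛ q ^ₛ p) *ₛ C ≈⟨ copies-≥1 m a g a₀≡0
                               (λ k → a≡1 (suc k) ((λ _ → s≤s z≤n) , p≢t , λ 2∣p → contradiction 2∣p 2∤p)) ⟩
      q ^ₛ p *ₛ g         ∎

  -- The size `t` is absent and contributes 1, so `oddFactor t` has nothing to cancel. This is the
  -- origin of the factor `1 - qᵗ` for odd `t`.
  at-mex : p ≡ t → oddFactor p *ₛ C ≈ₛ oddFactor t *ₛ g
  at-mex refl = *ₛ-congˡ {oddFactor p} (copies-0 m a g
    (a≡1 0 ((λ p<p → contradiction p<p (ℕP.<-irrefl refl)) , (λ _ → refl) , λ _ → z≤n))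
    (λ k → a≡0 (suc k) λ (_ , absent , _) → contradiction (absent refl) λ ()))

  -- An even size occurs at most once; at an odd size the full geometric series cancels against
  -- `oddFactor p`.
  above-mex : t < p → oddFactor p *ₛ C ≈ₛ evenFactor p *ₛ g
  above-mex t<p = byParity (2 ∣? p)
    where
    p≮t : ∀ {k} → p < t → 1 ≤ k
    p≮t p<t = contradiction p<t (ℕP.<⇒≯ t<p)
    p≢t : ∀ {k} → p ≡ t → k ≡ 0
    p≢t p≡t = contradiction (sym p≡t) (ℕP.<⇒≢ t<p)
    byParity : Dec (2 ∣ p) → oddFactor p *ₛ C ≈ₛ evenFactor p *ₛ g
    byParity (yes 2∣p) = begin
      oddFactor p *ₛ C    ≈⟨ *ₛ-congʳ {C} (≈ₛ-reflexive (oddFactor-even 2∣p)) ⟩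
      1ₛ *ₛ C             ≈⟨ *ₛ-identityˡ C ⟩
      C                   ≈⟨ copies-≤1 m a g (a≡1 0 (p≮t , p≢t , λ _ → z≤n)) (a≡1 1 (p≮t , p≢t , λ _ → s≤s z≤n))
                               (λ k → a≡0 (suc (suc k)) λ (_ , _ , atMostOnce) → 2≰1 (atMostOnce 2∣p)) ⟩
      (1ₛ +ₛ q ^ₛ p) *ₛ g ≈⟨ *ₛ-congʳ {g} (≈ₛ-reflexive (evenFactor-even 2∣p)) ⟨
      evenFactor p *ₛ g   ∎
    byParity (no 2∤p) = begin
      oddFactor p *ₛ C    ≈⟨ *ₛ-congʳ {C} (≈ₛ-reflexive (oddFactor-odd 2∤p)) ⟩
      (1ₛ -ₛ q ^ₛ p) *ₛ C ≈⟨ copies-all m a g (λ k → a≡1 k (p≮t , p≢t , λ 2∣p → contradiction 2∣p 2∤p)) ⟩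
      g                   ≈⟨ *ₛ-identityˡ g ⟨
      1ₛ *ₛ g             ≈⟨ *ₛ-congʳ {g} (≈ₛ-reflexive (evenFactor-odd 2∤p)) ⟨
      evenFactor p *ₛ g   ∎

-- Products over all part sizes.

∏ : (ℕ → Series) → ℕ → Series
∏ F zero    = 1ₛ
∏ F (suc m) = F (suc m) *ₛ ∏ F m

triangular : ℕ → ℕ
triangular zero    = 0
triangular (suc m) = suc m + triangular m

module _ (t : ℕ) where
  private
    T : ℕ → Series
    T = restrictedCount (allowed? t)
    D = ∏ oddFactor
    E = ∏ evenFactor

    step : ∀ u m → oddFactor (suc m) *ₛ copies m (λ k → ⟦ allowed? t (suc m) k ⟧) (T m) ≈ₛ u *ₛ T m →
           D (suc m) *ₛ T (suc m) ≈ₛ u *ₛ (D m *ₛ T m)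
    step u m eq = begin
      (d *ₛ D m) *ₛ T (suc m) ≈⟨ *ₛ-congˡ {d *ₛ D m} (restrictedCount-suc (allowed? t) m) ⟩
      (d *ₛ D m) *ₛ C         ≈⟨ solve 3 (λ d x c → (d :* x) :* c := x :* (d :* c)) ≈ₛ-refl d (D m) C ⟩
      D m *ₛ (d *ₛ C)         ≈⟨ *ₛ-congˡ {D m} eq ⟩
      D m *ₛ (u *ₛ T m)       ≈⟨ solve 3 (λ x u y → x :* (u :* y) := u :* (x :* y)) ≈ₛ-refl (D m) u (T m) ⟩
      u *ₛ (D m *ₛ T m)       ∎
      where
      d = oddFactor (suc m)
      C = copies m (λ k → ⟦ allowed? t (suc m) k ⟧) (T m)

  -- Every size up to `m` contributes just `qᵖ`, starting from the empty partition at `m = 0`; the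
  -- exponents add up to the triangular number.
  product-below-mex : ∀ m → m < t → D m *ₛ T m ≈ₛ q ^ₛ triangular m
  product-below-mex zero _ =
    ≈ₛ-trans (*ₛ-identityˡ (T 0)) (λ { zero → refl ; (suc _) → refl })
  product-below-mex (suc m) m<t = begin
    D (suc m) *ₛ T (suc m)              ≈⟨ step (q ^ₛ suc m) m (below-mex t m (T m) m<t) ⟩
    q ^ₛ suc m *ₛ (D m *ₛ T m)          ≈⟨ *ₛ-congˡ {q ^ₛ suc m} (product-below-mex m (ℕP.<⇒≤ m<t)) ⟩
    q ^ₛ suc m *ₛ q ^ₛ triangular m     ≈⟨ ^ₛ-+ q (suc m) (triangular m) ⟨
    q ^ₛ triangular (suc m)             ∎

  -- The sizes above `t` contribute `E m` divided by `E t`; multiplying by `E t` avoids the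
  -- division. The induction starts at `m = t`, where `at-mex` meets `product-below-mex`.
  product-above-mex : ∀ s → t ≡ suc s → ∀ m → t ≤ m →
    (D m *ₛ T m) *ₛ E t ≈ₛ (oddFactor t *ₛ q ^ₛ triangular s) *ₛ E m
  product-above-mex s t≡1+s zero    t≤0   = contradiction (ℕP.≤-trans (ℕP.≤-reflexive (sym t≡1+s)) t≤0) λ ()
  product-above-mex s t≡1+s (suc m) t≤1+m with ℕP.m≤n⇒m<n∨m≡n t≤1+m
  product-above-mex s refl (suc m) t≤1+m | inj₂ refl =
    *ₛ-congʳ {E (suc m)} (≈ₛ-trans (step (oddFactor t) m (at-mex t m (T m) refl)) (*ₛ-congˡ {oddFactor t} (product-below-mex m ℕP.≤-refl)))
  product-above-mex s t≡1+s (suc m) t≤1+m | inj₁ t<1+m = begin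
    (D (suc m) *ₛ T (suc m)) *ₛ E t  ≈⟨ *ₛ-congʳ {E t} (step e m (above-mex t m (T m) t<1+m)) ⟩
    (e *ₛ (D m *ₛ T m)) *ₛ E t       ≈⟨ *ₛ-assoc e (D m *ₛ T m) (E t) ⟩
    e *ₛ ((D m *ₛ T m) *ₛ E t)       ≈⟨ *ₛ-congˡ {e} (product-above-mex s t≡1+s m (ℕP.≤-pred t<1+m)) ⟩
    e *ₛ (c *ₛ E m)                  ≈⟨ solve 3 (λ e c x → e :* (c :* x) := c :* (e :* x)) ≈ₛ-refl e c (E m) ⟩
    c *ₛ (e *ₛ E m)                  ∎
    where
    e = evenFactor (suc m)
    c = oddFactor t *ₛ q ^ₛ triangular s

-- The finite products as q-Pochhammer symbols.

2∣even : ∀ j → 2 ∣ suc (suc (j * 2))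
2∣even j = divides (suc j) refl

2∤odd : ∀ j → ¬ 2 ∣ suc (j * 2)
2∤odd j 2∣ = contradiction (∣1⇒≡1 (∣m+n∣m⇒∣n (subst (2 ∣_) (ℕP.+-comm 1 (j * 2)) 2∣) (divides j refl))) λ ()

∏-oddFactor : ∀ L → ∏ oddFactor (L * 2) ≈ₛ poch q q² L
∏-oddFactor zero    = ≈ₛ-refl
∏-oddFactor (suc L) = begin
  oddFactor (suc (suc (L * 2))) *ₛ (oddFactor (suc (L * 2)) *ₛ P)
    ≈⟨ *ₛ-congʳ {oddFactor (suc (L * 2)) *ₛ P} (≈ₛ-reflexive (oddFactor-even (2∣even L))) ⟩
  1ₛ *ₛ (oddFactor (suc (L * 2)) *ₛ P)
    ≈⟨ *ₛ-identityˡ (oddFactor (suc (L * 2)) *ₛ P) ⟩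
  oddFactor (suc (L * 2)) *ₛ P
    ≈⟨ *ₛ-cong factor (∏-oddFactor L) ⟩
  poch q q² (suc L) ∎
  where
  P = ∏ oddFactor (L * 2)
  factor : oddFactor (suc (L * 2)) ≈ₛ 1ₛ -ₛ q *ₛ q² ^ₛ L
  factor = begin
    oddFactor (suc (L * 2))      ≈⟨ ≈ₛ-reflexive (oddFactor-odd (2∤odd L)) ⟩
    1ₛ -ₛ q *ₛ q ^ₛ (L * 2)      ≈⟨ +ₛ-cong {1ₛ} {1ₛ} ≈ₛ-refl (-ₛ-cong (*ₛ-congˡ {q} (q²^ₛ L))) ⟨
    1ₛ -ₛ q *ₛ q² ^ₛ L           ∎

-- For an odd mex `2L + 1` the denominator thus has index `L`, whereas for an even mex `2L + 2` it
-- has index `L + 1`.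
∏-evenFactor-suc : ∀ L → ∏ evenFactor (suc (L * 2)) ≈ₛ ∏ evenFactor (L * 2)
∏-evenFactor-suc L =
  ≈ₛ-trans (*ₛ-congʳ {∏ evenFactor (L * 2)} (≈ₛ-reflexive (evenFactor-odd (2∤odd L)))) (*ₛ-identityˡ (∏ evenFactor (L * 2)))

∏-evenFactor : ∀ L → ∏ evenFactor (L * 2) ≈ₛ poch (-ₛ q²) q² L
∏-evenFactor zero    = ≈ₛ-refl
∏-evenFactor (suc L) = *ₛ-cong factor (≈ₛ-trans (∏-evenFactor-suc L) (∏-evenFactor L))
  where
  factor : evenFactor (suc (suc (L * 2))) ≈ₛ 1ₛ -ₛ (-ₛ q²) *ₛ q² ^ₛ L
  factor = begin
    evenFactor (suc (suc (L * 2)))    ≈⟨ ≈ₛ-reflexive (evenFactor-even (2∣even L)) ⟩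
    1ₛ +ₛ q ^ₛ (suc L * 2)            ≈⟨ +ₛ-cong {1ₛ} {1ₛ} ≈ₛ-refl (q²^ₛ (suc L)) ⟨
    1ₛ +ₛ q² *ₛ q² ^ₛ L               ≈⟨ +ₛ-cong {1ₛ} {1ₛ} ≈ₛ-refl (-‿involutive (q² *ₛ q² ^ₛ L)) ⟨
    1ₛ -ₛ (-ₛ (q² *ₛ q² ^ₛ L))        ≈⟨ +ₛ-cong {1ₛ} {1ₛ} ≈ₛ-refl (-ₛ-cong (-‿distribˡ-* q² (q² ^ₛ L))) ⟩
    1ₛ -ₛ (-ₛ q²) *ₛ q² ^ₛ L          ∎

-- Summation over the mex and passage to the limit.

*ₛ-partialSum : ∀ A B F G N → (∀ j → j < N → A *ₛ F j ≈ₛ B *ₛ G j) →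
                A *ₛ partialSum F N ≈ₛ B *ₛ partialSum G N
*ₛ-partialSum A B F G zero    eq = ≈ₛ-trans (*ₛ-zeroʳ A) (≈ₛ-sym (*ₛ-zeroʳ B))
*ₛ-partialSum A B F G (suc N) eq = begin
  A *ₛ (partialSum F N +ₛ F N)      ≈⟨ *ₛ-distribˡ A (partialSum F N) (F N) ⟩
  A *ₛ partialSum F N +ₛ A *ₛ F N   ≈⟨ +ₛ-cong (*ₛ-partialSum A B F G N (λ j j<N → eq j (ℕP.m<n⇒m<1+n j<N))) (eq N ℕP.≤-refl) ⟩
  B *ₛ partialSum G N +ₛ B *ₛ G N   ≈⟨ *ₛ-distribˡ B (partialSum G N) (G N) ⟨
  B *ₛ (partialSum G N +ₛ G N)      ∎

partialSum-minus : ∀ F G N → partialSum (λ j → F j -ₛ G j) N ≈ₛ partialSum F N -ₛ partialSum G N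
partialSum-minus F G zero    k = refl
partialSum-minus F G (suc N) k =
  trans (cong (ℤ._+ (F N k ℤ.- G N k)) (partialSum-minus F G N k)) (lemma (partialSum F N k) (partialSum G N k) (F N k) (G N k))
  where
  lemma : ∀ a b c d → (a ℤ.- b) ℤ.+ (c ℤ.- d) ≡ (a ℤ.+ c) ℤ.- (b ℤ.+ d)
  lemma = solve-∀

-- Convergence with an explicit rate: coefficient `k` is final once `k + 1` terms have been added.
-- The Pochhammer products settle at the same rate, so one truncation serves all limits.
SumsTo : (ℕ → Series) → Series → Set
SumsTo F S = ∀ k N → k < N → S k ≡ partialSum F N k

-- Both parities are treated at once: `b = 0` gives odd mex, `b = 1` even mex. `term j` is the
-- contribution of mex `t = target b j`, and `b + j * 2` is `t - 1`.
module _ {b} (b<2 : b < 2) (term P : ℕ → Series) (S : Series)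
  (P₀≡1    : ∀ j → P j 0 ≡ 1ℤ)
  (∏≈P     : ∀ j → ∏ evenFactor (target b j) ≈ₛ P j)
  (term≈   : ∀ j → term j ≈ₛ (oddFactor (target b j) *ₛ q ^ₛ triangular (b + j * 2)) /ₛ P j)
  (sumsTo  : SumsTo term S)
  where
  private
    T : ℕ → ℕ → Series
    T L j = restrictedCount (allowed? (target b j)) (L * 2)

    D E : ℕ → Series
    D L = ∏ oddFactor (L * 2)
    E L = ∏ evenFactor (L * 2)

    D∞ E∞ A : Series
    D∞ = poch∞ q q² refl
    E∞ = poch∞ (-ₛ q²) q² refl
    A  = genFun (countByMexParity (suc b % 2))

  -- An exact identity at every finite stage: `j < L` puts the mex within the part bound, and
  -- `product-above-mex` is divided by `P j`, which is `∏ evenFactor t`.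
  mex-term : ∀ L j → j < L → D L *ₛ T L j ≈ₛ E L *ₛ term j
  mex-term L j j<L = begin
    D L *ₛ T L j              ≈⟨ *ₛ-cancelˡ {P j} (P₀≡1 j) product ⟩
    (c *ₛ E L) *ₛ recip (P j) ≈⟨ solve 3 (λ c e r → (c :* e) :* r := e :* (c :* r)) ≈ₛ-refl c (E L) (recip (P j)) ⟩
    E L *ₛ (c /ₛ P j)         ≈⟨ *ₛ-congˡ {E L} (term≈ j) ⟨
    E L *ₛ term j             ∎
    where
    t = target b j
    c = oddFactor t *ₛ q ^ₛ triangular (b + j * 2)
    product : P j *ₛ (D L *ₛ T L j) ≈ₛ c *ₛ E L
    product = begin
      P j *ₛ (D L *ₛ T L j)            ≈⟨ *ₛ-comm (P j) (D L *ₛ T L j) ⟩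
      (D L *ₛ T L j) *ₛ P j            ≈⟨ *ₛ-congˡ {D L *ₛ T L j} (∏≈P j) ⟨
      (D L *ₛ T L j) *ₛ ∏ evenFactor t ≈⟨ product-above-mex t (b + j * 2) refl (L * 2) (target-≤ b<2 j<L) ⟩
      c *ₛ E L                         ∎

  countByMexParity-series : A ≈ₛ (E∞ /ₛ D∞) *ₛ S
  countByMexParity-series = begin
    A                        ≈⟨ *ₛ-cancelˡ {D∞} (poch∞-constant q q² refl refl) coefficient ⟩
    (E∞ *ₛ S) *ₛ recip D∞    ≈⟨ solve 3 (λ e s r → (e :* s) :* r := (e :* r) :* s) ≈ₛ-refl E∞ S (recip D∞) ⟩
    (E∞ /ₛ D∞) *ₛ S          ∎
    where
    coefficient : D∞ *ₛ A ≈ₛ E∞ *ₛ S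
    -- With `L = suc n`, all coefficients up to `n` of both infinite products, of `A` and of `S`
    -- agree with stage `L`. The limits are replaced by this stage, the finite identity is applied,
    -- and the limits are restored.
    coefficient n = trans
      (*ₛ-local {D∞} {D L} {A} {partialSum (T L) L} n
        (λ k k≤n → trans (sym (proj₂ (poch-convergent q q² refl k) L (s≤s k≤n))) (sym (∏-oddFactor L k)))
        (λ k k≤n → countByMexParity-decomposition b<2 (s≤s k≤n)))
      (trans (*ₛ-partialSum (D L) (E L) (T L) term L (mex-term L) n)
      (*ₛ-local {E L} {E∞} {partialSum term L} {S} n
        (λ k k≤n → trans (∏-evenFactor L k) (proj₂ (poch-convergent (-ₛ q²) q² refl k) L (s≤s k≤n)))
        (λ k k≤n → sym (sumsTo k L (s≤s k≤n)))))
      where L = suc n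

-- Exponents and the two identities.

triangular-even : ∀ j → triangular (j * 2) ≡ 2 * j ^ 2 + j
triangular-even zero    = refl
triangular-even (suc j) = trans (cong (λ z → suc (suc (j * 2)) + (suc (j * 2) + z)) (triangular-even j)) (lemma j)
  where
  lemma : ∀ j → suc (suc (j * 2)) + (suc (j * 2) + (2 * (j * (j * 1)) + j)) ≡ 2 * (suc j * (suc j * 1)) + suc j
  lemma = ℕSolver.solve-∀

-- This exponent serves twice: it is the weight of the parts forced by mex `2j + 2`, and for mex
-- `2j + 1` it is the exponent of the subtracted term, `2j + 1` more than `triangular (j * 2)`.
triangular-odd : ∀ j → triangular (suc (j * 2)) ≡ (2 * j + 1) * (j + 1)
triangular-odd j = trans (cong (suc (j * 2) +_) (triangular-even j)) (lemma j)
  where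
  lemma : ∀ j → suc (j * 2) + (2 * (j * (j * 1)) + j) ≡ (2 * j + 1) * (j + 1)
  lemma = ℕSolver.solve-∀

-- The truncated subtraction is exact, since adding `1 + j` to the left side gives
-- `2 * (1 + j) ^ 2`.
triangular-odd-∸ : ∀ j → triangular (suc (j * 2)) ≡ 2 * (1 + j) ^ 2 ∸ (1 + j)
triangular-odd-∸ j = trans (triangular-odd j)
  (trans (sym (ℕP.m+n∸n≡m ((2 * j + 1) * (j + 1)) (1 + j))) (cong (_∸ (1 + j)) (lemma j)))
  where
  lemma : ∀ j → (2 * j + 1) * (j + 1) + (1 + j) ≡ 2 * ((1 + j) * ((1 + j) * 1))
  lemma = ℕSolver.solve-∀

q^ₛ-cong : ∀ {m n} → m ≡ n → q ^ₛ m ≈ₛ q ^ₛ n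
q^ₛ-cong refl = ≈ₛ-refl

theorem1p11 : (genFun aᵒed ≈ₛ
    (poch∞ (-ₛ q²) q² refl /ₛ poch∞ q q² refl) *ₛ
    (∑from 0 (λ n → q ^ₛ (2 * n ^ 2 + n) /ₛ poch (-ₛ q²) q² n) summable-2n²+n
    -ₛ ∑from 0 (λ n → q ^ₛ ((2 * n + 1) * (n + 1)) /ₛ poch (-ₛ q²) q² n) summable-[2n+1][n+1]))
    ×
    (genFun aᵉed ≈ₛ
    (poch∞ (-ₛ q²) q² refl /ₛ poch∞ q q² refl) *ₛ
    ∑from 1 (λ n → q ^ₛ (2 * n ^ 2 ∸ n) /ₛ poch (-ₛ q²) q² n) summable-2n²-n)
theorem1p11 = odd-mex , even-mex
  where
  P : ℕ → Series
  P = poch (-ₛ q²) q²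

  f g h : ℕ → Series
  f n = q ^ₛ (2 * n ^ 2 + n) /ₛ P n
  g n = q ^ₛ ((2 * n + 1) * (n + 1)) /ₛ P n
  h n = q ^ₛ (2 * n ^ 2 ∸ n) /ₛ P n

  -- Mex `2j + 1` corresponds to the `j`-th terms of the two series jointly.
  odd-mex = countByMexParity-series {0} (s≤s z≤n) (λ j → f j -ₛ g j) P
    (∑from 0 f summable-2n²+n -ₛ ∑from 0 g summable-[2n+1][n+1])
    (poch-constant (-ₛ q²) q² refl)
    (λ j → ≈ₛ-trans (∏-evenFactor-suc j) (∏-evenFactor j))
    (λ j → let d = oddFactor (suc (j * 2)); Q = q ^ₛ triangular (j * 2); Q′ = q ^ₛ suc (j * 2); r = recip (P j) in begin
      f j -ₛ g j
        ≈⟨ -ₛ-distribʳ r (q ^ₛ (2 * j ^ 2 + j)) (q ^ₛ ((2 * j + 1) * (j + 1))) ⟨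
      (q ^ₛ (2 * j ^ 2 + j) -ₛ q ^ₛ ((2 * j + 1) * (j + 1))) *ₛ r
        ≈⟨ *ₛ-congʳ {r} (+ₛ-cong (q^ₛ-cong (triangular-even j)) (-ₛ-cong (q^ₛ-cong (triangular-odd j)))) ⟨
      (Q -ₛ q ^ₛ triangular (suc (j * 2))) *ₛ r
        -- Pulling `Q` out of both powers exposes the factor `1 - qᵗ` for `t = 2j + 1`, which is
        -- `oddFactor t`.
        ≈⟨ *ₛ-congʳ {r} (+ₛ-cong (≈ₛ-sym (*ₛ-identityˡ Q)) (-ₛ-cong (^ₛ-+ q (suc (j * 2)) (triangular (j * 2))))) ⟩
      (1ₛ *ₛ Q -ₛ Q′ *ₛ Q) *ₛ r
        ≈⟨ *ₛ-congʳ {r} (-ₛ-distribʳ Q 1ₛ Q′) ⟨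
      ((1ₛ -ₛ Q′) *ₛ Q) *ₛ r
        ≈⟨ *ₛ-congʳ {r} (*ₛ-congʳ {Q} (≈ₛ-reflexive (oddFactor-odd (2∤odd j)))) ⟨
      (d *ₛ Q) *ₛ r ∎)
    (λ k N k<N → trans
      (cong₂ ℤ._-_ (sym (proj₂ (summable-2n²+n k) N k<N)) (sym (proj₂ (summable-[2n+1][n+1] k) N k<N)))
      (sym (partialSum-minus f g N k)))

  -- Mex `2j + 2` corresponds to the term of index `j + 1`. Here `oddFactor` is 1, so nothing is
  -- subtracted.
  even-mex = countByMexParity-series {1} (s≤s (s≤s z≤n)) (λ j → h (suc j)) (λ j → P (suc j)) (∑from 1 h summable-2n²-n)
    (λ j → poch-constant (-ₛ q²) q² refl (suc j))
    (λ j → ∏-evenFactor (suc j))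
    (λ j → let d = oddFactor (suc (suc (j * 2))); Q = q ^ₛ triangular (suc (j * 2)); r = recip (P (suc j)) in begin
      h (suc j)       ≈⟨ *ₛ-congʳ {r} (q^ₛ-cong (triangular-odd-∸ j)) ⟨
      Q *ₛ r          ≈⟨ *ₛ-congʳ {r} (*ₛ-identityˡ Q) ⟨
      (1ₛ *ₛ Q) *ₛ r  ≈⟨ *ₛ-congʳ {r} (*ₛ-congʳ {Q} (≈ₛ-reflexive (oddFactor-even (2∣even j)))) ⟨
      (d *ₛ Q) *ₛ r   ∎)
    (λ k N k<N → sym (proj₂ (summable-2n²-n k) N k<N))
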